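{- Let $A$ be a self-adjoint generalized ring and $s\in A_{[1]}$. The map $\Psi:A_s\to\mathcal O_A(D_s)$ sending $a/s^n\in(A_s)_X$ to the section $\mathfrak p\mapsto a/s^n\in(A_{\mathfrak p})_X$ ($\mathfrak p\in D_s$) is a well-defined isomorphism of generalized rings. In particular (for $s=1$) the map $A\to\mathcal O_A(spec(A))$, $a\mapsto(\mathfrak p\mapsto a/1)$, is an isomorphism.
   Context: All sets $X,Y,Z,W$ below are finite. A partial map $f:X\rightharpoonup Y$ is a map $f:D(f)\to Y$ defined on a subset $D(f)\subseteq X$; $Set_\bullet(X,Y)$ is the set of partial maps. $\mathbb F_\bullet$ is the category of finite sets with partial bijections; $f^t$ is the inverse. $[1]=\{1\}$, $c_X:X\to[1]$ the total map. A generalized ring $A$ consists of: a functor $X\mapsto A_X$ from $\mathbb F_\bullet$ to pointed sets with $A_\emptyset=\{0\}$; $A_f=\prod_{y\in Y}A_{f^{ -1}(y)}$ for $f\in Set_\bullet(X,Y)$ (so $A_{c_X}=A_X$, $A_{id_X}=(A_{[1]})^X$); multiplications $\circ:A_Y\times A_f\to A_X$ and contractions $(\,,\,):A_X\times A_f\to A_Y$, zero when an argument is zero, extended fibrewise for $g\in Set_\bullet(Y,Z)$ to $\circ:A_g\times A_f\to A_{g\circ f}$, $(\,,\,):A_{g\circ f}\times A_f\to A_g$ via $(a\circ b)^{(z)}=a^{(z)}\circ b|_z$, $(c,b)^{(z)}=(c^{(z)},b|_z)$ ($b|_z=(b^{(y)})_{y\in g^{ -1}(z)}$ for the restriction $f|_z:(g\circ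 f)^{ -1}(z)\rightharpoonup g^{ -1}(z)$); and a unit $1\in A_{[1]}$ (with transports $1_x$, and $1_f\in A_f$ for partial bijections $f$ with components $1_{f^t(y)}$ on the image, $0$ elsewhere); satisfying for $W\xleftarrow{h}Z\xleftarrow{g}Y\xleftarrow{f}X$: $d\circ(c\circ b)=(d\circ c)\circ b$; $(d,a\circ c)=((d,c),a)$ ($d\in A_{h\circ g\circ f},a\in A_g,c\in A_f$); $(d\circ c,a)=(d,(a,c))$ ($d\in A_{h\circ g},a\in A_{g\circ f},c\in A_f$); $(d\circ a,c)=d\circ(a,c)$ ($d\in A_h,a\in A_{g\circ f},c\in A_f$); for $Z\xrightarrow{g}Y\xleftarrow{f}X$, $h\in Set_\bullet(Y,W)$, $P=\{(z,x)\in D(g)\times D(f):g(z)=f(x)\}$ with projections $\tilde f,\tilde g$, $\tilde c^{(z)}=c^{(g(z))}$, $\tilde a^{(x)}=a^{(f(x))}$: $(d,c)\circ a=(d\circ\tilde a,\tilde c)$ ($d\in A_{h\circ f},a\in A_g,c\in A_f$); $a\circ1_{id_X}=1_{id_Y}\circ a=(a,1_{id_X})=a$ ($a\in A_f$); $a\circ1_{f^t}=(a,1_f)=f_A(a)$ ($a\in A_X$, $f$ a partial bijection). $A_{[1]}$ is a commutative monoid under $\circ$, acting on $A_X$ via $\circ:A_{[1]}\times A_{c_X}\to A_X$. $A$ is self-adjoint if $(1,a)=a$ for all $a\in A_{[1]}$. Homomorphisms are families of base-point preserving maps $\varphi_X$ preserving $\circ$, contraction and $1$. An h-ideal is a subset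 $\mathfrak a\subseteq A_{[1]}$ with $(b\circ c,d)\in\mathfrak a$ for all finite $X$, $b,d\in A_X$, $c\in\mathfrak a^X\subseteq(A_{[1]})^X$; proper if $1\notin\mathfrak a$. A prime is a proper h-ideal $\mathfrak p$ with $a\circ b\in\mathfrak p\Rightarrow a\in\mathfrak p$ or $b\in\mathfrak p$; $spec(A)$ is the set of primes with the Zariski topology (closed sets $V(\mathfrak a)=\{\mathfrak p\supseteq\mathfrak a\}$, $\mathfrak a\subseteq A_{[1]}$); $D_s=\{\mathfrak p: s\notin\mathfrak p\}$. Localization: for $S\subseteq A_{[1]}$ with $1\in S$, $S\circ S\subseteq S$, $(S^{ -1}A)_X$ is $A_X\times S$ modulo $(a_1,s_1)\approx(a_2,s_2)$ iff $s\circ s_2\circ a_1=s\circ s_1\circ a_2$ for some $s\in S$; the class is written $a/s$; elements of $(S^{ -1}A)_f$ are written with a common denominator, $a/s_1\circ b/s_2=(a\circ b)/(s_1\circ s_2)$, $(a/s_1,b/s_2)=(a,b)/(s_1\circ s_2)$, unit $1/1$. $A_s=S^{ -1}A$ for $S=\{s^n:n\ge0\}$; $A_{\mathfrak p}=S^{ -1}A$ for $S=A_{[1]}\setminus\mathfrak p$. Structure sheaf: for $U\subseteq spec(A)$ open and $X$ finite, $\mathcal O_A(U)_X$ is the set of functions $f$ on $U$ with $f(\mathfrak p)\in(A_{\mathfrak p})_X$ that are locally fractions: every $\mathfrak p\in U$ has an open neighbourhood $U'\subseteq U$ and $a\in A_X$, $s\in A_{[1]}$ lying in no prime of $U'$,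 with $f(\mathfrak q)=a/s$ for all $\mathfrak q\in U'$. With pointwise operations $\mathcal O_A(U)$ is a generalized ring. -}

module Defs where

open import Algebra.Bundles using (CommutativeMonoid)
import Algebra.Solver.CommutativeMonoid as CommutativeMonoidSolver
open import Axiom.UniquenessOfIdentityProofs.WithK using (uip)
open import Data.Empty using (⊥)
open import Data.Fin.Base using (Fin; zero; suc)
import Data.Fin.Properties as Fin
open import Data.Maybe.Base using (Maybe; just; nothing; _>>=_)
open import Data.Maybe.Properties using (just-injective; ≡-dec)
open import Data.Nat.Base using (ℕ; zero; suc; _+_)
open import Data.Product.Base using (Σ-syntax; ∃; ∃-syntax; _×_; _,_; proj₁; proj₂)
open import Data.Product.Function.NonDependent.Propositional using (_×-↔_)
open import Data.Sum.Base using (_⊎_; [_,_]′)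
open import Data.Unit.Base using (⊤; tt)
open import Function.Base using (id)
open import Function.Bundles using (_↔_; mk↔ₛ′; _⇔_; mk⇔; module Inverse; module Equivalence)
open import Function.Construct.Composition using (_↔-∘_)
open import Function.Construct.Symmetry using (↔-sym)
open import Function.Definitions using (Congruent; Bijective)
open import Level using (_⊔_) renaming (suc to lsuc; zero to 0ℓ)
open import Relation.Binary.Bundles using (Poset; Setoid)
open import Relation.Binary.Core using (Rel)
open import Relation.Binary.Definitions using (DecidableEquality)
open import Relation.Binary.PropositionalEquality.Core
  using (_≡_; refl; sym; trans; cong; subst)
import Relation.Binary.Reasoning.Setoid as SetoidReasoning
open import Relation.Binary.Structures using (IsEquivalence)
open import Relation.Nullary using (Dec; yes; no; contradiction)
open import Relation.Unary using (Pred; _∈_; _∉_; _⊆_; Decidable; Irrelevant)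

-- Without η, the sets defined below by copatterns stay neutral, which lets
-- unification recover X and f from fib f y.
record FinSet : Set₁ where
  no-eta-equality
  field
    ∣_∣    : Set
    size   : ℕ
    finite : ∣_∣ ↔ Fin size

open FinSet public using (∣_∣)

private
  ΣFin : ∀ {n} (Q : Fin n → Set) → Decidable Q → Irrelevant Q →
         Σ[ k ∈ ℕ ] (∃ Q ↔ Fin k)
  ΣFin {zero} Q Q? irr = 0 , mk↔ₛ′ (λ ()) (λ ()) (λ ()) (λ ())
  ΣFin {suc n} Q Q? irr with ΣFin (λ i → Q (suc i)) (λ i → Q? (suc i)) irr | Q? zero
  ... | k , e | yes q = suc k , mk↔ₛ′ to from to∘from from∘to
    where
    module e = Inverse e
    to : ∃ Q → Fin (suc k)
    to (zero  , _) = zero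
    to (suc i , r) = suc (e.to (i , r))
    from : Fin (suc k) → ∃ Q
    from zero    = zero , q
    from (suc j) = suc (proj₁ (e.from j)) , proj₂ (e.from j)
    to∘from : ∀ j → to (from j) ≡ j
    to∘from zero    = refl
    to∘from (suc j) = cong suc (e.strictlyInverseˡ j)
    from∘to : ∀ x → from (to x) ≡ x
    from∘to (zero  , r) = cong (zero ,_) (irr q r)
    from∘to (suc i , r) =
      cong (λ p → suc (proj₁ p) , proj₂ p) (e.strictlyInverseʳ (i , r))
  ... | k , e | no ¬q = k , mk↔ₛ′ to from to∘from from∘to
    where
    module e = Inverse e
    to : ∃ Q → Fin k
    to (zero  , r) = contradiction r ¬q
    to (suc i , r) = e.to (i , r)
    from : Fin k → ∃ Q
    from j = suc (proj₁ (e.from j)) , proj₂ (e.from j)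
    to∘from : ∀ j → to (from j) ≡ j
    to∘from j = e.strictlyInverseˡ j
    from∘to : ∀ x → from (to x) ≡ x
    from∘to (zero  , r) = contradiction r ¬q
    from∘to (suc i , r) =
      cong (λ p → suc (proj₁ p) , proj₂ p) (e.strictlyInverseʳ (i , r))

decEq : (X : FinSet) → DecidableEquality ∣ X ∣
decEq X x y with Inverse.to (FinSet.finite X) x Fin.≟ Inverse.to (FinSet.finite X) y
... | yes e = yes (trans (sym (e.strictlyInverseʳ x)) (trans (cong e.from e′) (e.strictlyInverseʳ y)))
  where module e = Inverse (FinSet.finite X)
        e′ = e
... | no ¬e = no (λ { refl → ¬e refl })

module _ (X : FinSet) (Q : Pred ∣ X ∣ 0ℓ) (Q? : Decidable Q) (irr : Irrelevant Q) where

  private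
    module e = Inverse (FinSet.finite X)

    ΣX≡ : ∀ {x y} {p : Q x} {q : Q y} → x ≡ y → _≡_ {A = ∃ Q} (x , p) (y , q)
    ΣX≡ refl = cong (_ ,_) (irr _ _)

    ΣFin≡ : ∀ {i j} {p : Q (e.from i)} {q : Q (e.from j)} → i ≡ j →
            _≡_ {A = ∃ (λ i → Q (e.from i))} (i , p) (j , q)
    ΣFin≡ refl = cong (_ ,_) (irr _ _)

    reindex : ∃ Q ↔ ∃ (λ i → Q (e.from i))
    reindex = mk↔ₛ′
      (λ (x , q) → e.to x , subst Q (sym (e.strictlyInverseʳ x)) q)
      (λ (i , q) → e.from i , q)
      (λ (i , q) → ΣFin≡ (e.strictlyInverseˡ i))
      (λ (x , q) → ΣX≡ (e.strictlyInverseʳ x))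

    count = ΣFin (λ i → Q (e.from i)) (λ i → Q? (e.from i)) irr

  subset : FinSet
  subset .∣_∣           = ∃ Q
  subset .FinSet.size   = proj₁ count
  subset .FinSet.finite = proj₂ count ↔-∘ reindex

∅ : FinSet
∅ .∣_∣           = ⊥
∅ .FinSet.size   = 0
∅ .FinSet.finite = ↔-sym Fin.0↔⊥

[1] : FinSet
[1] .∣_∣           = ⊤
[1] .FinSet.size   = 1
[1] .FinSet.finite = ↔-sym Fin.1↔⊤

infixr 2 _×ˢ_
_×ˢ_ : FinSet → FinSet → FinSet
U ×ˢ V = record
  { ∣_∣    = ∣ U ∣ × ∣ V ∣
  ; size   = _
  ; finite = ↔-sym Fin.*↔× ↔-∘ (FinSet.finite U ×-↔ FinSet.finite V)
  }

infixr 9 _∙_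
infix  4 _⇀_ _⇌_ _≗ᵖ_
infix  11 _ᵗ

record _⇀_ (X Y : FinSet) : Set where
  constructor partial
  infixl 10 _·_
  field _·_ : ∣ X ∣ → Maybe ∣ Y ∣

open _⇀_ public

total : ∀ {X Y} → (∣ X ∣ → ∣ Y ∣) → X ⇀ Y
total t = partial (λ x → just (t x))

idᵖ : ∀ {X} → X ⇀ X
idᵖ = total id

_∙_ : ∀ {X Y Z} → Y ⇀ Z → X ⇀ Y → X ⇀ Z
g ∙ f = partial λ x → f · x >>= g ·_

_≗ᵖ_ : ∀ {X Y} → X ⇀ Y → X ⇀ Y → Set
f ≗ᵖ f′ = ∀ x → f · x ≡ f′ · x

! : ∀ X → X ⇀ [1]
! X = total (λ _ → tt)

module _ {X Y : FinSet} where

  private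
    fibre : X ⇀ Y → ∣ Y ∣ → FinSet
    fibre f y = subset X (λ x → f · x ≡ just y) (λ x → ≡-dec (decEq Y) (f · x) (just y)) uip

  fib : X ⇀ Y → ∣ Y ∣ → FinSet
  fib f y .∣_∣           = ∃[ x ] f · x ≡ just y
  fib f y .FinSet.size   = FinSet.size (fibre f y)
  fib f y .FinSet.finite = FinSet.finite (fibre f y)

  fib≡ : (f : X ⇀ Y) {y : ∣ Y ∣} {x x′ : ∣ X ∣}
         {p : f · x ≡ just y} {p′ : f · x′ ≡ just y} →
         x ≡ x′ → _≡_ {A = ∣ fib f y ∣} (x , p) (x′ , p′)
  fib≡ f refl = cong (_ ,_) (uip _ _)

-- The restriction f|_z : (g ∙ f)⁻¹(z) → g⁻¹(z); it is total.
module _ {X Y Z : FinSet} (g : Y ⇀ Z) (f : X ⇀ Y) (z : ∣ Z ∣) where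

  split : (m : Maybe ∣ Y ∣) → (m >>= g ·_) ≡ just z → ∣ fib g z ∣
  split (just y) e = y , e

  restrict : fib (g ∙ f) z ⇀ fib g z
  restrict = total (λ (x , e) → split (f · x) e)

-- A partial bijection is a partial map together with its inverse fᵗ.
record _⇌_ (X Y : FinSet) : Set where
  field
    map     : X ⇀ Y
    inv     : Y ⇀ X
    map⇒inv : ∀ {x y} → map · x ≡ just y → inv · y ≡ just x
    inv⇒map : ∀ {x y} → inv · y ≡ just x → map · x ≡ just y

open _⇌_ public using (map; inv)

_ᵗ : ∀ {X Y} → X ⇌ Y → Y ⇌ X
φ ᵗ = record { map = φ.inv ; inv = φ.map ; map⇒inv = φ.inv⇒map ; inv⇒map = φ.map⇒inv }
  where module φ = _⇌_ φ

idᵇ : ∀ {X} → X ⇌ X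
idᵇ = record { map = idᵖ ; inv = idᵖ ; map⇒inv = flip ; inv⇒map = flip }
  where
  flip : ∀ {A : Set} {x y : A} → just x ≡ just y → just y ≡ just x
  flip = sym

_∙ᵇ_ : ∀ {X Y Z} → Y ⇌ Z → X ⇌ Y → X ⇌ Z
_∙ᵇ_ {X} {Y} {Z} ψ φ = record
  { map     = map ψ ∙ map φ
  ; inv     = inv φ ∙ inv ψ
  ; map⇒inv = swap (map φ) (map ψ) (inv φ) (inv ψ) φ.map⇒inv ψ.map⇒inv
  ; inv⇒map = swap (inv ψ) (inv φ) (map ψ) (map φ) ψ.inv⇒map φ.inv⇒map
  }
  where
  module φ = _⇌_ φ
  module ψ = _⇌_ ψ
  swap : ∀ {U V W} (f : U ⇀ V) (g : V ⇀ W) (f′ : V ⇀ U) (g′ : W ⇀ V) →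
         (∀ {u v} → f · u ≡ just v → f′ · v ≡ just u) →
         (∀ {v w} → g · v ≡ just w → g′ · w ≡ just v) →
         ∀ {u w} → (g ∙ f) · u ≡ just w → (f′ ∙ g′) · w ≡ just u
  swap f g f′ g′ p q {u} {w} e with f · u in eq
  ... | just v rewrite q e = p eq

-- The inclusion of the fibre f⁻¹(y) ⊆ X.
incl : ∀ {X Y} (f : X ⇀ Y) (y : ∣ Y ∣) → fib f y ⇌ X
incl {X} {Y} f y = record
  { map     = total proj₁
  ; inv     = partial (λ x → dec x (f∋? x))
  ; map⇒inv = λ { {x , p} refl → dec-yes x p (f∋? x) }
  ; inv⇒map = λ {u} {x} e → dec-just u x (f∋? x) e
  }
  where
  f∋? : ∀ x → Dec (f · x ≡ just y)
  f∋? x = ≡-dec (decEq Y) (f · x) (just y)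
  dec : ∀ x → Dec (f · x ≡ just y) → Maybe ∣ fib f y ∣
  dec x (yes p) = just (x , p)
  dec x (no _)  = nothing
  dec-yes : ∀ x (p : f · x ≡ just y) d → dec x d ≡ just (x , p)
  dec-yes x p (yes p′) = cong just (fib≡ f refl)
  dec-yes x p (no ¬p)  = contradiction p ¬p
  dec-just : ∀ u x d → dec x d ≡ just u → just (proj₁ u) ≡ just x
  dec-just u x (yes p) refl = refl

-- The partial bijection [1] ⇌ X with image {x}.
point : ∀ {X} → ∣ X ∣ → [1] ⇌ X
point {X} x = record
  { map     = total (λ _ → x)
  ; inv     = partial (λ x′ → dec (decEq X x x′))
  ; map⇒inv = λ { refl → dec-yes (decEq X x x) }
  ; inv⇒map = λ {_} {x′} → dec-just (decEq X x x′)
  }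
  where
  dec : ∀ {x′} → Dec (x ≡ x′) → Maybe ⊤
  dec (yes _) = just tt
  dec (no _)  = nothing
  dec-yes : (d : Dec (x ≡ x)) → dec d ≡ just tt
  dec-yes (yes _) = refl
  dec-yes (no ¬e) = contradiction refl ¬e
  dec-just : ∀ {x′} (d : Dec (x ≡ x′)) → dec d ≡ just tt → just x ≡ just x′
  dec-just (yes e) _ = cong just e

module _ {X Y Z : FinSet} (g : Z ⇀ Y) (f : X ⇀ Y) where

  -- P = {(z , x) ∈ D(g) × D(f) : g(z) = f(x)}
  Match : Pred (∣ Z ∣ × ∣ X ∣) 0ℓ
  Match (z , x) = ∃[ y ] (g · z ≡ just y × f · x ≡ just y)

  match? : Decidable Match
  match? (z , x) with g · z | f · x
  ... | nothing | _       = no (λ { (_ , () , _) })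
  ... | just _  | nothing = no (λ { (_ , _ , ()) })
  ... | just y  | just y′ with decEq Y y y′
  ...   | yes e = yes (y , refl , cong just (sym e))
  ...   | no ¬e = no (λ { (_ , refl , refl) → ¬e refl })

  match-irr : Irrelevant Match
  match-irr (y , p , q) (y′ , p′ , q′) with just-injective (trans (sym p) p′)
  ... | refl with uip p p′ | uip q q′
  ...   | refl | refl = refl

  pullback : FinSet
  pullback .∣_∣           = ∃ Match
  pullback .FinSet.size   = FinSet.size (subset (Z ×ˢ X) Match match? match-irr)
  pullback .FinSet.finite = FinSet.finite (subset (Z ×ˢ X) Match match? match-irr)

  π₁ : pullback ⇀ Z
  π₁ = total (λ ((z , _) , _) → z)

  π₂ : pullback ⇀ X
  π₂ = total (λ ((_ , x) , _) → x)

bij : ∀ {U V} (t : ∣ U ∣ → ∣ V ∣) (t⁻¹ : ∣ V ∣ → ∣ U ∣) →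
      (∀ u → t⁻¹ (t u) ≡ u) → (∀ v → t (t⁻¹ v) ≡ v) → U ⇌ V
bij t t⁻¹ p q = record
  { map     = total t
  ; inv     = total t⁻¹
  ; map⇒inv = λ { refl → cong just (p _) }
  ; inv⇒map = λ { refl → cong just (q _) }
  }

module _ {X Y Z : FinSet} (g : Z ⇀ Y) (f : X ⇀ Y) where

  fib-π₁ : ∀ {z y} → g · z ≡ just y → fib f y ⇌ fib (π₁ g f) z
  fib-π₁ {z} {y} e = bij
    (λ (x , p) → ((z , x) , y , e , p) , refl)
    (λ (((_ , x) , y′ , e′ , p) , r) → x , back e′ p r)
    (λ _ → fib≡ f refl)
    (λ { (((_ , x) , _) , refl) → fib≡ (π₁ g f) (cong (_ ,_) (match-irr g f _ _)) })
    where
    back : ∀ {z′ x y′} → g · z′ ≡ just y′ → f · x ≡ just y′ → just z′ ≡ just z → f · x ≡ just y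
    back e′ p refl = trans p (trans (sym e′) e)

  fib-π₂ : ∀ {x y} → f · x ≡ just y → fib g y ⇌ fib (π₂ g f) x
  fib-π₂ {x} {y} e = bij
    (λ (z , p) → ((z , x) , y , p , e) , refl)
    (λ (((z , _) , y′ , p , e′) , r) → z , back p e′ r)
    (λ _ → fib≡ g refl)
    (λ { (((z , _) , _) , refl) → fib≡ (π₂ g f) (cong (_ ,_) (match-irr g f _ _)) })
    where
    back : ∀ {z x′ y′} → g · z ≡ just y′ → f · x′ ≡ just y′ → just x′ ≡ just x → g · z ≡ just y
    back p e′ refl = trans p (trans (sym e′) e)

record RawGeneralizedRing a ℓ : Set (lsuc (lsuc 0ℓ ⊔ a ⊔ ℓ)) where

  infix  4 _≈_ _≈ᶠ_
  infixr 7 _∘[_]_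
  infixr 8 _•_

  field
    El  : FinSet → Set a
    _≈_ : ∀ {X} → Rel (El X) ℓ
    0#  : ∀ {X} → El X
    1#  : El [1]
    act : ∀ {X Y} → X ⇌ Y → El X → El Y  -- f_A

  -- A_f
  Fam : ∀ {X Y} → X ⇀ Y → Set a
  Fam f = ∀ y → El (fib f y)

  _≈ᶠ_ : ∀ {X Y} {f : X ⇀ Y} → Rel (Fam f) ℓ
  b ≈ᶠ b′ = ∀ y → b y ≈ b′ y

  0ᶠ : ∀ {X Y} {f : X ⇀ Y} → Fam f
  0ᶠ _ = 0#

  field
    _∘[_]_   : ∀ {X Y} → El Y → (f : X ⇀ Y) → Fam f → El X
    -- The contraction (c , b).
    ⟨_∣[_]_⟩ : ∀ {X Y} → El X → (f : X ⇀ Y) → Fam f → El Y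

  -- Subsets of X that coincide in mathematics are here different types,
  -- such as f⁻¹(y) and f′⁻¹(y) for f ≗ᵖ f′.  The canonical bijection
  -- between two such subsets U , V is always (incl V)ᵗ ∙ incl U.

  recast : ∀ {X Y} (f f′ : X ⇀ Y) → Fam f → Fam f′
  recast f f′ b y = act (incl f′ y ᵗ) (act (incl f y) (b y))

  ⌜_⌝ : ∀ {X} → El X → Fam (! X)
  ⌜_⌝ {X} x y = act (incl (! X) y ᵗ) x

  -- The action of A_[1] on A_X.
  _•_ : ∀ {X} → El [1] → El X → El X
  s • x = s ∘[ ! _ ] ⌜ x ⌝

  -- A_{id_X} = (A_[1])^X
  diag : ∀ {X} → (∣ X ∣ → El [1]) → Fam (idᵖ {X})
  diag c x = act (point (x , refl)) (c x)

  -- b|_z; note (f|_z)⁻¹(y) = f⁻¹(y) as subsets of X.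
  restrictᶠ : ∀ {X Y Z} (g : Y ⇀ Z) (f : X ⇀ Y) → Fam f → ∀ z → Fam (restrict g f z)
  restrictᶠ g f b z (y , e) =
    act (incl (restrict g f z) (y , e) ᵗ) (act (incl (g ∙ f) z ᵗ) (act (incl f y) (b y)))

  infix 7 [_∣_]_∘ᶠ_

  [_∣_]_∘ᶠ_ : ∀ {X Y Z} (g : Y ⇀ Z) (f : X ⇀ Y) → Fam g → Fam f → Fam (g ∙ f)
  ([ g ∣ f ] a ∘ᶠ b) z = a z ∘[ restrict g f z ] restrictᶠ g f b z

  [_∣_]⟨_∣ᶠ_⟩ : ∀ {X Y Z} (g : Y ⇀ Z) (f : X ⇀ Y) → Fam (g ∙ f) → Fam f → Fam g
  [ g ∣ f ]⟨ c ∣ᶠ b ⟩ z = ⟨ c z ∣[ restrict g f z ] restrictᶠ g f b z ⟩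

  -- 1_f: the transport of 1 along y ↦ fᵗ(y), which is 0 off the image.
  1ᶠ : ∀ {X Y} (f : X ⇌ Y) → Fam (map f)
  1ᶠ f y = act (incl (map f) y ᵗ) (act (f ᵗ) (act (point y) 1#))

  module _ {X Y Z : FinSet} (g : Z ⇀ Y) (f : X ⇀ Y) where

    -- c̃ ∈ A_f̃ and ã ∈ A_g̃, where f̃ = π₁ and g̃ = π₂.

    pull₁At : ∀ {z} → Fam f → (m : Maybe ∣ Y ∣) → g · z ≡ m → El (fib (π₁ g f) z)
    pull₁At c nothing  _ = 0#
    pull₁At c (just y) e = act (fib-π₁ g f e) (c y)

    pull₁ : Fam f → Fam (π₁ g f)
    pull₁ c z = pull₁At c (g · z) refl

    pull₂At : ∀ {x} → Fam g → (m : Maybe ∣ Y ∣) → f · x ≡ m → El (fib (π₂ g f) x)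
    pull₂At a nothing  _ = 0#
    pull₂At a (just y) e = act (fib-π₂ g f e) (a y)

    pull₂ : Fam g → Fam (π₂ g f)
    pull₂ a x = pull₂At a (f · x) refl

record IsGeneralizedRing {a ℓ} (R : RawGeneralizedRing a ℓ) : Set (lsuc 0ℓ ⊔ a ⊔ ℓ) where

  open RawGeneralizedRing R

  field
    isEquivalence : ∀ {X} → IsEquivalence (_≈_ {X})

    act-cong : ∀ {X Y} {φ ψ : X ⇌ Y} {x y} → map φ ≗ᵖ map ψ → x ≈ y → act φ x ≈ act ψ y
    act-id   : ∀ {X} (x : El X) → act idᵇ x ≈ x
    act-∙    : ∀ {X Y Z} (ψ : Y ⇌ Z) (φ : X ⇌ Y) x → act (ψ ∙ᵇ φ) x ≈ act ψ (act φ x)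
    act-0    : ∀ {X Y} (φ : X ⇌ Y) → act φ 0# ≈ 0#
    El-∅     : (x : El ∅) → x ≈ 0#

    -- ≗ᵖ is the equality of partial maps, so the operations respect it too.
    ∘-cong   : ∀ {X Y} {f f′ : X ⇀ Y} → f ≗ᵖ f′ → ∀ {a a′ b b′} →
               a ≈ a′ → recast f f′ b ≈ᶠ b′ → a ∘[ f ] b ≈ a′ ∘[ f′ ] b′
    ⟨⟩-cong  : ∀ {X Y} {f f′ : X ⇀ Y} → f ≗ᵖ f′ → ∀ {c c′ b b′} →
               c ≈ c′ → recast f f′ b ≈ᶠ b′ → ⟨ c ∣[ f ] b ⟩ ≈ ⟨ c′ ∣[ f′ ] b′ ⟩

    ∘-zeroˡ  : ∀ {X Y} (f : X ⇀ Y) b → 0# ∘[ f ] b ≈ 0#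
    ∘-zeroʳ  : ∀ {X Y} (f : X ⇀ Y) a → a ∘[ f ] 0ᶠ ≈ 0#
    ⟨⟩-zeroˡ : ∀ {X Y} (f : X ⇀ Y) b → ⟨ 0# ∣[ f ] b ⟩ ≈ 0#
    ⟨⟩-zeroʳ : ∀ {X Y} (f : X ⇀ Y) c → ⟨ c ∣[ f ] 0ᶠ ⟩ ≈ 0#

    -- A_X = A_{c_X} makes the basic operations the fibrewise ones over c_Y.
    -- As c_Y ∘ f has domain D(f), this passes between A_X and A_{D(f)}.
    -- In set theory this is notation for the extension; here the identity
    -- c_X⁻¹(1) = X is a bijection, and the operations must respect it.
    ∘-fibrewise  : ∀ {X Y} (f : X ⇀ Y) a b → let D = incl (! Y ∙ f) tt in
                   a ∘[ f ] b ≈ act D (([ ! Y ∣ f ] ⌜ a ⌝ ∘ᶠ b) tt)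
    ⟨⟩-fibrewise : ∀ {X Y} (f : X ⇀ Y) c b → let D = incl (! Y ∙ f) tt in
                   ⟨ c ∣[ f ] b ⟩ ≈
                   act (incl (! Y) tt) ([ ! Y ∣ f ]⟨ (λ _ → act (D ᵗ) c) ∣ᶠ b ⟩ tt)

    ∘-assoc    : ∀ {W X Y Z} (h : Z ⇀ W) (g : Y ⇀ Z) (f : X ⇀ Y) d c b →
                 recast (h ∙ (g ∙ f)) ((h ∙ g) ∙ f) ([ h ∣ g ∙ f ] d ∘ᶠ ([ g ∣ f ] c ∘ᶠ b))
                 ≈ᶠ [ h ∙ g ∣ f ] ([ h ∣ g ] d ∘ᶠ c) ∘ᶠ b
    ⟨⟩-∘       : ∀ {W X Y Z} (h : Z ⇀ W) (g : Y ⇀ Z) (f : X ⇀ Y) d a c →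
                 [ h ∣ g ∙ f ]⟨ d ∣ᶠ [ g ∣ f ] a ∘ᶠ c ⟩
                 ≈ᶠ [ h ∣ g ]⟨ [ h ∙ g ∣ f ]⟨ recast (h ∙ (g ∙ f)) ((h ∙ g) ∙ f) d ∣ᶠ c ⟩ ∣ᶠ a ⟩
    ∘-⟨⟩       : ∀ {W X Y Z} (h : Z ⇀ W) (g : Y ⇀ Z) (f : X ⇀ Y) d c a →
                 [ h ∣ g ∙ f ]⟨ recast ((h ∙ g) ∙ f) (h ∙ (g ∙ f)) ([ h ∙ g ∣ f ] d ∘ᶠ c) ∣ᶠ a ⟩
                 ≈ᶠ [ h ∣ g ]⟨ d ∣ᶠ [ g ∣ f ]⟨ a ∣ᶠ c ⟩ ⟩
    ∘-⟨⟩-assoc : ∀ {W X Y Z} (h : Z ⇀ W) (g : Y ⇀ Z) (f : X ⇀ Y) d a c →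
                 [ h ∙ g ∣ f ]⟨ recast (h ∙ (g ∙ f)) ((h ∙ g) ∙ f) ([ h ∣ g ∙ f ] d ∘ᶠ a) ∣ᶠ c ⟩
                 ≈ᶠ [ h ∣ g ] d ∘ᶠ [ g ∣ f ]⟨ a ∣ᶠ c ⟩
    ⟨⟩-pull    : ∀ {W X Y Z} (h : Y ⇀ W) (g : Z ⇀ Y) (f : X ⇀ Y) d c a →
                 [ h ∣ g ] [ h ∣ f ]⟨ d ∣ᶠ c ⟩ ∘ᶠ a
                 ≈ᶠ [ h ∙ g ∣ π₁ g f ]⟨
                      recast ((h ∙ f) ∙ π₂ g f) ((h ∙ g) ∙ π₁ g f)
                        ([ h ∙ f ∣ π₂ g f ] d ∘ᶠ pull₂ g f a)
                      ∣ᶠ pull₁ g f c ⟩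

    ∘-identityʳ  : ∀ {X Y} (f : X ⇀ Y) a → [ f ∣ idᵖ ] a ∘ᶠ 1ᶠ idᵇ ≈ᶠ a
    ∘-identityˡ  : ∀ {X Y} (f : X ⇀ Y) a → recast (idᵖ ∙ f) f ([ idᵖ ∣ f ] 1ᶠ idᵇ ∘ᶠ a) ≈ᶠ a
    ⟨⟩-identityʳ : ∀ {X Y} (f : X ⇀ Y) a → [ f ∣ idᵖ ]⟨ a ∣ᶠ 1ᶠ idᵇ ⟩ ≈ᶠ a
    ∘-act        : ∀ {X Y} (f : X ⇌ Y) a → a ∘[ inv f ] 1ᶠ (f ᵗ) ≈ act f a
    ⟨⟩-act       : ∀ {X Y} (f : X ⇌ Y) a → ⟨ a ∣[ map f ] 1ᶠ f ⟩ ≈ act f a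

record GeneralizedRing a ℓ : Set (lsuc (lsuc 0ℓ ⊔ a ⊔ ℓ)) where
  field
    raw               : RawGeneralizedRing a ℓ
    isGeneralizedRing : IsGeneralizedRing raw

  open RawGeneralizedRing raw public
  open IsGeneralizedRing isGeneralizedRing public

SelfAdjoint : ∀ {a ℓ} → GeneralizedRing a ℓ → Set (a ⊔ ℓ)
SelfAdjoint A = ∀ x → ⟨ 1# ∣[ ! [1] ] ⌜ x ⌝ ⟩ ≈ x
  where open GeneralizedRing A

module _ {a₁ ℓ₁ a₂ ℓ₂} (A : GeneralizedRing a₁ ℓ₁) (B : GeneralizedRing a₂ ℓ₂) where

  private
    module A = GeneralizedRing A
    module B = GeneralizedRing B

  -- Preservation of all the transports 1_x of 1 is part of act-homo.
  record IsHomomorphism (φ : ∀ X → A.El X → B.El X) : Set (lsuc 0ℓ ⊔ a₁ ⊔ ℓ₁ ⊔ a₂ ⊔ ℓ₂) where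
    field
      φ-cong   : ∀ X → Congruent A._≈_ B._≈_ (φ X)
      0-homo   : ∀ X → φ X A.0# B.≈ B.0#
      1-homo   : φ [1] A.1# B.≈ B.1#
      act-homo : ∀ {X Y} (f : X ⇌ Y) x → φ Y (A.act f x) B.≈ B.act f (φ X x)
      ∘-homo   : ∀ {X Y} (f : X ⇀ Y) x b → φ X (x A.∘[ f ] b) B.≈ φ Y x B.∘[ f ] (λ y → φ _ (b y))
      ⟨⟩-homo  : ∀ {X Y} (f : X ⇀ Y) x b → φ Y A.⟨ x ∣[ f ] b ⟩ B.≈ B.⟨ φ X x ∣[ f ] (λ y → φ _ (b y)) ⟩

  record IsIsomorphism (φ : ∀ X → A.El X → B.El X) : Set (lsuc 0ℓ ⊔ a₁ ⊔ ℓ₁ ⊔ a₂ ⊔ ℓ₂) where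
    field
      isHomomorphism : IsHomomorphism φ
      bijective      : ∀ X → Bijective A._≈_ B._≈_ (φ X)

module _ {a ℓ} (A : GeneralizedRing a ℓ) where

  open GeneralizedRing A

  private
    ≈-refl : ∀ {s : El [1]} → s ≈ s
    ≈-refl = IsEquivalence.refl isEquivalence

  record IsHIdeal {p} (𝔞 : Pred (El [1]) p) : Set (lsuc 0ℓ ⊔ a ⊔ ℓ ⊔ p) where
    field
      resp   : ∀ {s t} → s ≈ t → s ∈ 𝔞 → t ∈ 𝔞
      closed : ∀ {X} (b d : El X) (c : ∣ X ∣ → El [1]) → (∀ x → c x ∈ 𝔞) →
               ⟨ b ∘[ idᵖ ] diag c ∣[ ! X ] ⌜ d ⌝ ⟩ ∈ 𝔞

  record Spec : Set (lsuc 0ℓ ⊔ a ⊔ lsuc ℓ) where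
    field
      member   : Pred (El [1]) ℓ
      isHIdeal : IsHIdeal member
      proper   : 1# ∉ member
      prime    : ∀ {s t} → (s • t) ∈ member → s ∈ member ⊎ t ∈ member

    open IsHIdeal isHIdeal public

  infix 4 _∋_ _∌_

  _∋_ _∌_ : Spec → El [1] → Set ℓ
  𝔭 ∋ s = s ∈ Spec.member 𝔭
  𝔭 ∌ s = s ∉ Spec.member 𝔭

  -- The complement of V(𝔞) = {𝔭 : 𝔞 ⊆ 𝔭}, positively: 𝔭 misses an element of 𝔞.
  V∁ : Pred (El [1]) ℓ → Pred Spec (a ⊔ ℓ)
  V∁ 𝔞 𝔭 = ∃[ s ] (s ∈ 𝔞 × 𝔭 ∌ s)

  record Open u : Set (lsuc 0ℓ ⊔ a ⊔ lsuc ℓ ⊔ lsuc u) where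
    field
      points : Pred Spec u
      isOpen : ∃[ 𝔞 ] (∀ 𝔭 → 𝔭 ∈ points ⇔ 𝔭 ∈ V∁ 𝔞)

  -- D_s
  basicOpen : El [1] → Open ℓ
  basicOpen s = record
    { points = _∌ s
    ; isOpen = (s ≈_) , λ 𝔭 → mk⇔ (λ 𝔭∌s → s , ≈-refl , 𝔭∌s)
        (λ (t , s≈t , 𝔭∌t) 𝔭∋s → 𝔭∌t (Spec.resp 𝔭 s≈t 𝔭∋s))
    }

  spec : Open 0ℓ
  spec = record
    { points = λ _ → ⊤
    ; isOpen = (1# ≈_) , λ 𝔭 → mk⇔ (λ _ → 1# , ≈-refl , Spec.proper 𝔭) (λ _ → tt)
    }

module Lemmas {a ℓ} (A : GeneralizedRing a ℓ) where

  open GeneralizedRing A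

  module _ {X : FinSet} where
    open IsEquivalence (isEquivalence {X}) public
      renaming (refl to ≈-refl; sym to ≈-sym; trans to ≈-trans; reflexive to ≈-reflexive)

  setoid : FinSet → Setoid a ℓ
  setoid X = record { isEquivalence = isEquivalence {X} }

  module ≈-Reasoning {X} = SetoidReasoning (setoid X)
  open ≈-Reasoning

  act-congʳ : ∀ {X Y} (φ : X ⇌ Y) {x y} → x ≈ y → act φ x ≈ act φ y
  act-congʳ φ = act-cong (λ _ → refl)

  act₂ : ∀ {X Y Z} {ψ : Y ⇌ Z} {φ : X ⇌ Y} {χ : X ⇌ Z} →
         map ψ ∙ map φ ≗ᵖ map χ → ∀ x → act ψ (act φ x) ≈ act χ x
  act₂ e x = ≈-trans (≈-sym (act-∙ _ _ x)) (act-cong e ≈-refl)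

  act-id′ : ∀ {X} {φ : X ⇌ X} → map φ ≗ᵖ idᵖ → ∀ x → act φ x ≈ x
  act-id′ e x = ≈-trans (act-cong e ≈-refl) (act-id x)

  module _ {X Y} (f : X ⇀ Y) (y : ∣ Y ∣) where

    inclᵗ-incl : ∀ x → act (incl f y ᵗ) (act (incl f y) x) ≈ x
    inclᵗ-incl x = ≈-trans (act₂ {χ = idᵇ} (λ u → _⇌_.map⇒inv (incl f y) refl) x) (act-id x)

    incl-inclᵗ : (∀ x → f · x ≡ just y) → ∀ x → act (incl f y) (act (incl f y ᵗ) x) ≈ x
    incl-inclᵗ all x = ≈-trans (act₂ {χ = idᵇ} e x) (act-id x)
      where
      e : map (incl f y) ∙ map (incl f y ᵗ) ≗ᵖ idᵖ
      e x rewrite _⇌_.map⇒inv (incl f y) {x , all x} refl = refl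

  recast-id : ∀ {X Y} (f : X ⇀ Y) (b : Fam f) → recast f f b ≈ᶠ b
  recast-id f b y = inclᵗ-incl f y (b y)

  recast-cong : ∀ {X Y} (f f′ : X ⇀ Y) {b b′} → b ≈ᶠ b′ → recast f f′ b ≈ᶠ recast f f′ b′
  recast-cong f f′ e y = act-congʳ _ (act-congʳ _ (e y))

  ⌜⌝-incl : ∀ {X} (x : El X) → act (incl (! X) tt) (⌜ x ⌝ tt) ≈ x
  ⌜⌝-incl {X} x = incl-inclᵗ (! X) tt (λ _ → refl) x

  ⌜⌝-injective : ∀ {X} {x y : El X} → ⌜ x ⌝ tt ≈ ⌜ y ⌝ tt → x ≈ y
  ⌜⌝-injective e = ≈-trans (≈-sym (⌜⌝-incl _)) (≈-trans (act-congʳ _ e) (⌜⌝-incl _))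

  ⌜⌝-cong : ∀ {X} {x y : El X} → x ≈ y → ⌜ x ⌝ ≈ᶠ ⌜ y ⌝
  ⌜⌝-cong e _ = act-congʳ _ e

  ∘-cong′ : ∀ {X Y} (f : X ⇀ Y) {x x′ b b′} → x ≈ x′ → b ≈ᶠ b′ → x ∘[ f ] b ≈ x′ ∘[ f ] b′
  ∘-cong′ f {b = b} p q = ∘-cong (λ _ → refl) p (λ y → ≈-trans (recast-id f b y) (q y))

  ⟨⟩-cong′ : ∀ {X Y} (f : X ⇀ Y) {x x′ b b′} → x ≈ x′ → b ≈ᶠ b′ → ⟨ x ∣[ f ] b ⟩ ≈ ⟨ x′ ∣[ f ] b′ ⟩
  ⟨⟩-cong′ f {b = b} p q = ⟨⟩-cong (λ _ → refl) p (λ y → ≈-trans (recast-id f b y) (q y))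

  restrictᶠ-cong : ∀ {X Y Z} (g : Y ⇀ Z) (f : X ⇀ Y) {b b′} → b ≈ᶠ b′ →
                   ∀ z → restrictᶠ g f b z ≈ᶠ restrictᶠ g f b′ z
  restrictᶠ-cong g f e z (y , _) = act-congʳ _ (act-congʳ _ (act-congʳ _ (e y)))

  ∘ᶠ-cong : ∀ {X Y Z} (g : Y ⇀ Z) (f : X ⇀ Y) {x x′ b b′} → x ≈ᶠ x′ → b ≈ᶠ b′ →
            [ g ∣ f ] x ∘ᶠ b ≈ᶠ [ g ∣ f ] x′ ∘ᶠ b′
  ∘ᶠ-cong g f p q z = ∘-cong′ (restrict g f z) (p z) (restrictᶠ-cong g f q z)

  ⟨⟩ᶠ-cong : ∀ {X Y Z} (g : Y ⇀ Z) (f : X ⇀ Y) {x x′ b b′} → x ≈ᶠ x′ → b ≈ᶠ b′ →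
            [ g ∣ f ]⟨ x ∣ᶠ b ⟩ ≈ᶠ [ g ∣ f ]⟨ x′ ∣ᶠ b′ ⟩
  ⟨⟩ᶠ-cong g f p q z = ⟨⟩-cong′ (restrict g f z) (p z) (restrictᶠ-cong g f q z)

  -- The laws for W = [1] and total maps, in A_X rather than in A_{c_X}.

  module _ {X Y} (t : ∣ X ∣ → ∣ Y ∣) where
    private f = total {X} {Y} t

    ⌜∘⌝ : ∀ x b → ⌜ x ∘[ f ] b ⌝ ≈ᶠ [ ! Y ∣ f ] ⌜ x ⌝ ∘ᶠ b
    ⌜∘⌝ x b tt = ≈-trans (act-congʳ _ (∘-fibrewise f x b)) (inclᵗ-incl (! X) tt _)

    ⌜⟨⟩⌝ : ∀ x b → ⌜ ⟨ x ∣[ f ] b ⟩ ⌝ ≈ᶠ [ ! Y ∣ f ]⟨ ⌜ x ⌝ ∣ᶠ b ⟩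
    ⌜⟨⟩⌝ x b tt = ≈-trans (act-congʳ _ (⟨⟩-fibrewise f x b)) (inclᵗ-incl (! Y) tt _)

  module _ {X Y Z} (u : ∣ Y ∣ → ∣ Z ∣) (t : ∣ X ∣ → ∣ Y ∣) where
    private
      f = total {X} {Y} t
      g = total {Y} {Z} u

    ∘-assocᵗ : ∀ d x b → d ∘[ g ∙ f ] ([ g ∣ f ] x ∘ᶠ b) ≈ (d ∘[ g ] x) ∘[ f ] b
    ∘-assocᵗ d x b = ⌜⌝-injective (begin
      ⌜ d ∘[ g ∙ f ] ([ g ∣ f ] x ∘ᶠ b) ⌝ tt                   ≈⟨ ⌜∘⌝ (λ x → u (t x)) d _ tt ⟩
      ([ ! Z ∣ g ∙ f ] ⌜ d ⌝ ∘ᶠ ([ g ∣ f ] x ∘ᶠ b)) tt         ≈⟨ recast-id (! X) _ tt ⟨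
      recast (! X) (! X) ([ ! Z ∣ g ∙ f ] ⌜ d ⌝ ∘ᶠ ([ g ∣ f ] x ∘ᶠ b)) tt
        ≈⟨ ∘-assoc (! Z) g f ⌜ d ⌝ x b tt ⟩
      ([ ! Y ∣ f ] ([ ! Z ∣ g ] ⌜ d ⌝ ∘ᶠ x) ∘ᶠ b) tt
        ≈⟨ ∘ᶠ-cong (! Y) f (⌜∘⌝ u d x) (λ _ → ≈-refl) tt ⟨
      ([ ! Y ∣ f ] ⌜ d ∘[ g ] x ⌝ ∘ᶠ b) tt                     ≈⟨ ⌜∘⌝ t _ b tt ⟨
      ⌜ (d ∘[ g ] x) ∘[ f ] b ⌝ tt                             ∎)

    ⟨⟩-∘ᵗ : ∀ d x b → ⟨ d ∣[ g ∙ f ] [ g ∣ f ] x ∘ᶠ b ⟩ ≈ ⟨ ⟨ d ∣[ f ] b ⟩ ∣[ g ] x ⟩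
    ⟨⟩-∘ᵗ d x b = ⌜⌝-injective (begin
      ⌜ ⟨ d ∣[ g ∙ f ] [ g ∣ f ] x ∘ᶠ b ⟩ ⌝ tt                 ≈⟨ ⌜⟨⟩⌝ (λ x → u (t x)) d _ tt ⟩
      [ ! Z ∣ g ∙ f ]⟨ ⌜ d ⌝ ∣ᶠ [ g ∣ f ] x ∘ᶠ b ⟩ tt           ≈⟨ ⟨⟩-∘ (! Z) g f ⌜ d ⌝ x b tt ⟩
      [ ! Z ∣ g ]⟨ [ ! Y ∣ f ]⟨ recast (! X) (! X) ⌜ d ⌝ ∣ᶠ b ⟩ ∣ᶠ x ⟩ tt
        ≈⟨ ⟨⟩ᶠ-cong (! Z) g (⟨⟩ᶠ-cong (! Y) f (recast-id (! X) ⌜ d ⌝) (λ _ → ≈-refl)) (λ _ → ≈-refl) tt ⟩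
      [ ! Z ∣ g ]⟨ [ ! Y ∣ f ]⟨ ⌜ d ⌝ ∣ᶠ b ⟩ ∣ᶠ x ⟩ tt
        ≈⟨ ⟨⟩ᶠ-cong (! Z) g (⌜⟨⟩⌝ t d b) (λ _ → ≈-refl) tt ⟨
      [ ! Z ∣ g ]⟨ ⌜ ⟨ d ∣[ f ] b ⟩ ⌝ ∣ᶠ x ⟩ tt                 ≈⟨ ⌜⟨⟩⌝ u _ x tt ⟨
      ⌜ ⟨ ⟨ d ∣[ f ] b ⟩ ∣[ g ] x ⟩ ⌝ tt                       ∎)

    ∘-⟨⟩-assocᵗ : ∀ d x b → ⟨ d ∘[ g ∙ f ] x ∣[ f ] b ⟩ ≈ d ∘[ g ] [ g ∣ f ]⟨ x ∣ᶠ b ⟩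
    ∘-⟨⟩-assocᵗ d x b = ⌜⌝-injective (begin
      ⌜ ⟨ d ∘[ g ∙ f ] x ∣[ f ] b ⟩ ⌝ tt                       ≈⟨ ⌜⟨⟩⌝ t _ b tt ⟩
      [ ! Y ∣ f ]⟨ ⌜ d ∘[ g ∙ f ] x ⌝ ∣ᶠ b ⟩ tt
        ≈⟨ ⟨⟩ᶠ-cong (! Y) f (λ z → ≈-trans (⌜∘⌝ (λ x → u (t x)) d x z) (≈-sym (recast-id (! X) _ z)))
             (λ _ → ≈-refl) tt ⟩
      [ ! Y ∣ f ]⟨ recast (! X) (! X) ([ ! Z ∣ g ∙ f ] ⌜ d ⌝ ∘ᶠ x) ∣ᶠ b ⟩ tt
        ≈⟨ ∘-⟨⟩-assoc (! Z) g f ⌜ d ⌝ x b tt ⟩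
      ([ ! Z ∣ g ] ⌜ d ⌝ ∘ᶠ [ g ∣ f ]⟨ x ∣ᶠ b ⟩) tt             ≈⟨ ⌜∘⌝ u d _ tt ⟨
      ⌜ d ∘[ g ] [ g ∣ f ]⟨ x ∣ᶠ b ⟩ ⌝ tt                      ∎)

  module _ {X Y Z} (u : ∣ Z ∣ → ∣ Y ∣) (t : ∣ X ∣ → ∣ Y ∣) where
    private
      f = total {X} {Y} t
      g = total {Z} {Y} u
      P = pullback g f

    ⟨⟩-pullᵗ : ∀ d b x → ⟨ d ∣[ f ] b ⟩ ∘[ g ] x ≈ ⟨ d ∘[ π₂ g f ] pull₂ g f x ∣[ π₁ g f ] pull₁ g f b ⟩
    ⟨⟩-pullᵗ d b x = ⌜⌝-injective (begin
      ⌜ ⟨ d ∣[ f ] b ⟩ ∘[ g ] x ⌝ tt                           ≈⟨ ⌜∘⌝ u _ x tt ⟩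
      ([ ! Y ∣ g ] ⌜ ⟨ d ∣[ f ] b ⟩ ⌝ ∘ᶠ x) tt
        ≈⟨ ∘ᶠ-cong (! Y) g (⌜⟨⟩⌝ t d b) (λ _ → ≈-refl) tt ⟩
      ([ ! Y ∣ g ] [ ! Y ∣ f ]⟨ ⌜ d ⌝ ∣ᶠ b ⟩ ∘ᶠ x) tt           ≈⟨ ⟨⟩-pull (! Y) g f ⌜ d ⌝ b x tt ⟩
      [ ! Z ∣ π₁ g f ]⟨ recast (! P) (! P) ([ ! X ∣ π₂ g f ] ⌜ d ⌝ ∘ᶠ pull₂ g f x) ∣ᶠ pull₁ g f b ⟩ tt
        ≈⟨ ⟨⟩ᶠ-cong (! Z) (π₁ g f)
             (λ z → ≈-trans (recast-id (! P) _ z) (≈-sym (⌜∘⌝ _ d _ z))) (λ _ → ≈-refl) tt ⟩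
      [ ! Z ∣ π₁ g f ]⟨ ⌜ d ∘[ π₂ g f ] pull₂ g f x ⌝ ∣ᶠ pull₁ g f b ⟩ tt
        ≈⟨ ⌜⟨⟩⌝ _ _ _ tt ⟨
      ⌜ ⟨ d ∘[ π₂ g f ] pull₂ g f x ∣[ π₁ g f ] pull₁ g f b ⟩ ⌝ tt ∎)

  •-cong : ∀ {X} {s s′} {x x′ : El X} → s ≈ s′ → x ≈ x′ → s • x ≈ s′ • x′
  •-cong p q = ∘-cong′ (! _) p (⌜⌝-cong q)

  •-congʳ : ∀ {X} s {x x′ : El X} → x ≈ x′ → s • x ≈ s • x′
  •-congʳ s = •-cong ≈-refl

  •-assoc : ∀ {X} s t (x : El X) → s • (t • x) ≈ (s • t) • x
  •-assoc {X} s t x = ≈-trans (∘-cong′ (! X) ≈-refl (⌜∘⌝ _ t ⌜ x ⌝)) (∘-assocᵗ _ _ s ⌜ t ⌝ ⌜ x ⌝)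

  •-0 : ∀ {X} s → s • 0# {X} ≈ 0#
  •-0 s = ≈-trans (∘-cong′ (! _) ≈-refl (λ _ → act-0 _)) (∘-zeroʳ (! _) s)

  module _ {X Y} (t : ∣ X ∣ → ∣ Y ∣) where
    private f = total {X} {Y} t

    •-∘ᵗ : ∀ s x b → (s • x) ∘[ f ] b ≈ s • (x ∘[ f ] b)
    •-∘ᵗ s x b = ≈-sym (≈-trans (∘-cong′ (! X) ≈-refl (⌜∘⌝ t x b)) (∘-assocᵗ _ t s ⌜ x ⌝ b))

    •-⟨⟩ᵗ : ∀ s x b → ⟨ s • x ∣[ f ] b ⟩ ≈ s • ⟨ x ∣[ f ] b ⟩
    •-⟨⟩ᵗ s x b = ≈-trans (∘-⟨⟩-assocᵗ _ t s ⌜ x ⌝ b) (∘-cong′ (! Y) ≈-refl (λ z → ≈-sym (⌜⟨⟩⌝ t x b z)))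

  module _ {X Y} (f : X ⇀ Y) (y : ∣ Y ∣) where

    act-incl-• : ∀ s x → act (incl f y) (s • x) ≈ s • act (incl f y) x
    act-incl-• s x = begin
      act i (s • x)             ≈⟨ ⟨⟩-act i _ ⟨
      ⟨ s • x ∣[ map i ] 1ᶠ i ⟩ ≈⟨ •-⟨⟩ᵗ proj₁ s x _ ⟩
      s • ⟨ x ∣[ map i ] 1ᶠ i ⟩ ≈⟨ •-congʳ s (⟨⟩-act i x) ⟩
      s • act i x               ∎
      where i = incl f y

    act-inclᵗ-• : ∀ s x → act (incl f y ᵗ) (s • x) ≈ s • act (incl f y ᵗ) x
    act-inclᵗ-• s x = begin
      act (i ᵗ) (s • x)         ≈⟨ ∘-act (i ᵗ) _ ⟨
      (s • x) ∘[ map i ] 1ᶠ i   ≈⟨ •-∘ᵗ proj₁ s x _ ⟩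
      s • (x ∘[ map i ] 1ᶠ i)   ≈⟨ •-congʳ s (∘-act (i ᵗ) x) ⟩
      s • act (i ᵗ) x           ∎
      where i = incl f y

  module _ {X Y} (f : X ⇀ Y) where
    private
      D = incl (! Y ∙ f) tt
      r = λ b → restrictᶠ (! Y) f b tt

    •-∘ : ∀ s x b → (s • x) ∘[ f ] b ≈ s • (x ∘[ f ] b)
    •-∘ s x b = begin
      (s • x) ∘[ f ] b                                     ≈⟨ ∘-fibrewise f _ b ⟩
      act D (⌜ s • x ⌝ tt ∘[ restrict (! Y) f tt ] r b)
        ≈⟨ act-congʳ D (∘-cong′ _ (act-inclᵗ-• (! Y) tt s x) (λ _ → ≈-refl)) ⟩
      act D ((s • ⌜ x ⌝ tt) ∘[ restrict (! Y) f tt ] r b)  ≈⟨ act-congʳ D (•-∘ᵗ _ s _ (r b)) ⟩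
      act D (s • (⌜ x ⌝ tt ∘[ restrict (! Y) f tt ] r b))  ≈⟨ act-incl-• _ tt s _ ⟩
      s • act D (⌜ x ⌝ tt ∘[ restrict (! Y) f tt ] r b)    ≈⟨ •-congʳ s (∘-fibrewise f x b) ⟨
      s • (x ∘[ f ] b)                                     ∎

    •-⟨⟩ : ∀ s x b → ⟨ s • x ∣[ f ] b ⟩ ≈ s • ⟨ x ∣[ f ] b ⟩
    •-⟨⟩ s x b = begin
      ⟨ s • x ∣[ f ] b ⟩                                          ≈⟨ ⟨⟩-fibrewise f _ b ⟩
      act i ⟨ act (D ᵗ) (s • x) ∣[ restrict (! Y) f tt ] r b ⟩
        ≈⟨ act-congʳ i (⟨⟩-cong′ _ (act-inclᵗ-• _ tt s x) (λ _ → ≈-refl)) ⟩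
      act i ⟨ s • act (D ᵗ) x ∣[ restrict (! Y) f tt ] r b ⟩      ≈⟨ act-congʳ i (•-⟨⟩ᵗ _ s _ (r b)) ⟩
      act i (s • ⟨ act (D ᵗ) x ∣[ restrict (! Y) f tt ] r b ⟩)    ≈⟨ act-incl-• _ tt s _ ⟩
      s • act i ⟨ act (D ᵗ) x ∣[ restrict (! Y) f tt ] r b ⟩      ≈⟨ •-congʳ s (⟨⟩-fibrewise f x b) ⟨
      s • ⟨ x ∣[ f ] b ⟩                                          ∎
      where i = incl (! Y) tt

  act-• : ∀ {X Y} (φ : X ⇌ Y) s x → act φ (s • x) ≈ s • act φ x
  act-• φ s x = ≈-trans (≈-sym (⟨⟩-act φ _)) (≈-trans (•-⟨⟩ (map φ) s x _) (•-congʳ s (⟨⟩-act φ x)))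

  restrictᶠ-• : ∀ {X Y Z} (g : Y ⇀ Z) (f : X ⇀ Y) s b z →
                restrictᶠ g f (λ y → s • b y) z ≈ᶠ λ y → s • restrictᶠ g f b z y
  restrictᶠ-• g f s b z (y , e) =
    ≈-trans (act-congʳ _ (≈-trans (act-congʳ _ (act-• _ s (b y))) (act-• _ s _))) (act-• _ s _)

  act-point : ∀ {X Y} (φ : X ⇌ Y) {x y} → map φ · x ≡ just y →
              ∀ s → act φ (act (point x) s) ≈ act (point y) s
  act-point φ e = act₂ (λ _ → e)

  point-tt : ∀ s → act (point tt) s ≈ s
  point-tt = act-id′ (λ _ → refl)

  inclᵗ· : ∀ {X Y} (f : X ⇀ Y) {x y} (p : f · x ≡ just y) → inv (incl f y) · x ≡ just (x , p)
  inclᵗ· f {x} p = _⇌_.map⇒inv (incl f _) {x , p} refl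

  1ᶠ-point : ∀ {X Y} (φ : X ⇌ Y) {x y} (p : map φ · x ≡ just y) →
             1ᶠ φ y ≈ act (point (x , p)) 1#
  1ᶠ-point φ p =
    ≈-trans (act-congʳ _ (act-point (φ ᵗ) (_⇌_.map⇒inv φ p) 1#)) (act-point _ (inclᵗ· (map φ) p) 1#)

  ⌜⌝-point : ∀ s → ⌜ s ⌝ tt ≈ act (point (tt , refl)) s
  ⌜⌝-point s = ≈-trans (act-congʳ _ (≈-sym (point-tt s))) (act-point _ (inclᵗ· (! [1]) refl) s)

  1ᶠ-⌜⌝ : 1ᶠ idᵇ ≈ᶠ ⌜ 1# ⌝
  1ᶠ-⌜⌝ tt = ≈-trans (1ᶠ-point idᵇ refl) (≈-sym (⌜⌝-point 1#))

  •-identityˡ : ∀ {X} (x : El X) → 1# • x ≈ x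
  •-identityˡ {X} x = ⌜⌝-injective (begin
    ⌜ 1# • x ⌝ tt                                 ≈⟨ ⌜∘⌝ _ 1# ⌜ x ⌝ tt ⟩
    ([ ! [1] ∣ ! X ] ⌜ 1# ⌝ ∘ᶠ ⌜ x ⌝) tt          ≈⟨ ∘ᶠ-cong (! [1]) (! X) 1ᶠ-⌜⌝ (λ _ → ≈-refl) tt ⟨
    ([ ! [1] ∣ ! X ] 1ᶠ idᵇ ∘ᶠ ⌜ x ⌝) tt          ≈⟨ recast-id (! X) _ tt ⟨
    recast (! X) (! X) ([ ! [1] ∣ ! X ] 1ᶠ idᵇ ∘ᶠ ⌜ x ⌝) tt ≈⟨ ∘-identityˡ (! X) ⌜ x ⌝ tt ⟩
    ⌜ x ⌝ tt                                      ∎)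

  •-identityʳ : ∀ s → s • 1# ≈ s
  •-identityʳ s = begin
    s ∘[ ! [1] ] ⌜ 1# ⌝     ≈⟨ ∘-cong′ (! [1]) ≈-refl 1ᶠ-⌜⌝ ⟨
    s ∘[ idᵖ ] 1ᶠ idᵇ       ≈⟨ ∘-act idᵇ s ⟩
    act idᵇ s               ≈⟨ act-id s ⟩
    s                       ∎

  •-point : ∀ {X} (x : ∣ X ∣) s → s • act (point {X} x) 1# ≈ act (point x) s
  •-point x s = ≈-trans (≈-sym (act-• (point x) s 1#)) (act-congʳ _ (•-identityʳ s))

  -- The constant family s̃ ∈ A_{id_X}.

  ⟪_⟫ : ∀ {X} → El [1] → Fam (idᵖ {X})
  ⟪ s ⟫ y = s • 1ᶠ idᵇ y

  ⟪⟫-point : ∀ {X} s (x : ∣ X ∣) → ⟪_⟫ {X} s x ≈ act (point (x , refl)) s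
  ⟪⟫-point s x = ≈-trans (•-congʳ s (1ᶠ-point idᵇ refl)) (•-point _ s)

  ⟪⟫-∘ : ∀ {X Y} (t : ∣ X ∣ → ∣ Y ∣) s b →
         [ idᵖ ∣ total {X} {Y} t ] ⟪ s ⟫ ∘ᶠ b ≈ᶠ λ y → s • b y
  ⟪⟫-∘ {X} {Y} t s b y = ≈-trans (•-∘ (restrict idᵖ f y) s _ _)
    (•-congʳ s (≈-trans (≈-sym (recast-id f ([ idᵖ ∣ f ] 1ᶠ idᵇ ∘ᶠ b) y)) (∘-identityˡ f b y)))
    where f = total {X} {Y} t

  module _ (sa : SelfAdjoint A) where

    ⟨⟩-⟪⟫ : ∀ {X} (x : El X) s → ⟨ x ∣[ idᵖ ] ⟪ s ⟫ ⟩ ≈ s • x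
    ⟨⟩-⟪⟫ {X} x s = ≈-sym (begin
      s ∘[ ! X ] ⌜ x ⌝                                       ≈⟨ ∘-cong′ (! X) (sa s) (λ _ → ≈-refl) ⟨
      ⟨ 1# ∣[ ! [1] ] ⌜ s ⌝ ⟩ ∘[ ! X ] ⌜ x ⌝                 ≈⟨ ⟨⟩-pullᵗ {[1]} {[1]} {X} _ _ 1# ⌜ s ⌝ ⌜ x ⌝ ⟩
      ⟨ 1# ∘[ ! P ] pull₂ (! X) (! [1]) ⌜ x ⌝ ∣[ π ] pull₁ (! X) (! [1]) ⌜ s ⌝ ⟩
        ≈⟨ ⟨⟩-cong′ π (≈-trans (∘-cong′ (! P) ≈-refl pull-x) (•-identityˡ _))
             (λ z → ≈-trans (pull-s z) (≈-sym (⟪⟫-∘ _ s (1ᶠ (ψ ᵗ)) z))) ⟩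
      ⟨ act ψ x ∣[ π ] [ idᵖ ∣ π ] ⟪ s ⟫ ∘ᶠ 1ᶠ (ψ ᵗ) ⟩         ≈⟨ ⟨⟩-∘ᵗ id _ (act ψ x) ⟪ s ⟫ (1ᶠ (ψ ᵗ)) ⟩
      ⟨ ⟨ act ψ x ∣[ π ] 1ᶠ (ψ ᵗ) ⟩ ∣[ idᵖ ] ⟪ s ⟫ ⟩
        ≈⟨ ⟨⟩-cong′ idᵖ (≈-trans (⟨⟩-act (ψ ᵗ) _) (≈-trans (act₂ {χ = idᵇ} (λ _ → refl) x) (act-id x)))
             (λ _ → ≈-refl) ⟩
      ⟨ x ∣[ idᵖ ] ⟪ s ⟫ ⟩                                   ∎)
      where
      P = pullback (! X) (! [1])
      π = π₁ (! X) (! [1])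
      ψ : X ⇌ P
      ψ = bij (λ x → (x , tt) , tt , refl , refl) (λ ((x , _) , _) → x) (λ _ → refl)
              (λ { (_ , tt , refl , refl) → refl })
      pull-x : pull₂ (! X) (! [1]) ⌜ x ⌝ ≈ᶠ ⌜ act ψ x ⌝
      pull-x tt = ≈-trans (≈-sym (act-∙ _ _ x)) (≈-trans (act-cong e ≈-refl) (act-∙ _ _ x))
        where
        e : map (fib-π₂ (! X) (! [1]) refl) ∙ map (incl (! X) tt ᵗ) ≗ᵖ map (incl (! P) tt ᵗ) ∙ map ψ
        e x rewrite inclᵗ· (! X) {x} refl | inclᵗ· (! P) {(x , tt) , tt , refl , refl} refl = refl
      pull-s : pull₁ (! X) (! [1]) ⌜ s ⌝ ≈ᶠ λ z → s • 1ᶠ (ψ ᵗ) z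
      pull-s z = begin
        act (fib-π₁ (! X) (! [1]) refl) (⌜ s ⌝ tt)       ≈⟨ act-congʳ _ (⌜⌝-point s) ⟩
        act (fib-π₁ (! X) (! [1]) refl) (act (point (tt , refl)) s)
          ≈⟨ act-point (fib-π₁ (! X) (! [1]) refl) refl s ⟩
        act (point {fib π z} u) s          ≈⟨ •-point {fib π z} u s ⟨
        s • act (point {fib π z} u) 1#     ≈⟨ •-congʳ s (1ᶠ-point (ψ ᵗ) refl) ⟨
        s • 1ᶠ (ψ ᵗ) z           ∎
        where
        u : ∣ fib π z ∣
        u = ((z , tt) , tt , refl , refl) , refl

    ∘-⟪⟫ : ∀ {X} (x : El X) s → x ∘[ idᵖ ] ⟪ s ⟫ ≈ s • x
    ∘-⟪⟫ x s = begin
      x ∘[ idᵖ ] ⟪ s ⟫                            ≈⟨ ∘-cong′ idᵖ ≈-refl contract ⟨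
      x ∘[ idᵖ ] [ idᵖ ∣ idᵖ ]⟨ 1ᶠ idᵇ ∣ᶠ ⟪ s ⟫ ⟩ ≈⟨ ∘-⟨⟩-assocᵗ id id x (1ᶠ idᵇ) ⟪ s ⟫ ⟨
      ⟨ x ∘[ idᵖ ] 1ᶠ idᵇ ∣[ idᵖ ] ⟪ s ⟫ ⟩
        ≈⟨ ⟨⟩-cong′ idᵖ (≈-trans (∘-act idᵇ x) (act-id x)) (λ _ → ≈-refl) ⟩
      ⟨ x ∣[ idᵖ ] ⟪ s ⟫ ⟩                        ≈⟨ ⟨⟩-⟪⟫ x s ⟩
      s • x                                       ∎
      where
      restrict-⟪⟫ : ∀ z → restrictᶠ idᵖ idᵖ ⟪ s ⟫ z ≈ᶠ ⟪ s ⟫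
      restrict-⟪⟫ z (y , e) = begin
        act i₃ (act i₂ (act i₁ (⟪ s ⟫ y)))
          ≈⟨ act-congʳ i₃ (act-congʳ i₂ (act-congʳ i₁ (⟪⟫-point s y))) ⟩
        act i₃ (act i₂ (act i₁ (act (point (y , refl)) s)))
          ≈⟨ act-congʳ i₃ (act-congʳ i₂ (act-point i₁ refl s)) ⟩
        act i₃ (act i₂ (act (point y) s)) ≈⟨ act-congʳ i₃ (act-point i₂ (inclᵗ· idᵖ e) s) ⟩
        act i₃ (act (point (y , e)) s)    ≈⟨ act-point i₃ (inclᵗ· (restrict idᵖ idᵖ z) refl) s ⟩
        act (point ((y , e) , refl)) s    ≈⟨ ⟪⟫-point s (y , e) ⟨
        ⟪ s ⟫ (y , e)                     ∎
        where
        i₁ = incl idᵖ y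
        i₂ = incl (idᵖ ∙ idᵖ) z ᵗ
        i₃ = incl (restrict idᵖ idᵖ z) (y , e) ᵗ
      contract : [ idᵖ ∣ idᵖ ]⟨ 1ᶠ idᵇ ∣ᶠ ⟪ s ⟫ ⟩ ≈ᶠ ⟪ s ⟫
      contract z = ≈-trans (⟨⟩-cong′ idᵖ ≈-refl (restrict-⟪⟫ z)) (⟨⟩-⟪⟫ _ s)

    •-comm : ∀ s t → s • t ≈ t • s
    •-comm s t = ≈-trans (∘-cong′ idᵖ ≈-refl (λ _ → ≈-trans (⌜⌝-point t) (≈-sym (⟪⟫-point t tt)))) (∘-⟪⟫ s t)

    module _ {X Y} (t : ∣ X ∣ → ∣ Y ∣) where
      private f = total {X} {Y} t

      ∘-•ᵗ : ∀ s x b → x ∘[ f ] (λ y → s • b y) ≈ s • (x ∘[ f ] b)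
      ∘-•ᵗ s x b = begin
        x ∘[ f ] (λ y → s • b y)                ≈⟨ ∘-cong′ f ≈-refl (⟪⟫-∘ t s b) ⟨
        x ∘[ f ] ([ idᵖ ∣ f ] ⟪ s ⟫ ∘ᶠ b)       ≈⟨ ∘-assocᵗ id t x ⟪ s ⟫ b ⟩
        (x ∘[ idᵖ ] ⟪ s ⟫) ∘[ f ] b             ≈⟨ ∘-cong′ f (∘-⟪⟫ x s) (λ _ → ≈-refl) ⟩
        (s • x) ∘[ f ] b                        ≈⟨ •-∘ f s x b ⟩
        s • (x ∘[ f ] b)                        ∎

      ⟨⟩-•ᵗ : ∀ s x b → ⟨ x ∣[ f ] (λ y → s • b y) ⟩ ≈ s • ⟨ x ∣[ f ] b ⟩
      ⟨⟩-•ᵗ s x b = begin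
        ⟨ x ∣[ f ] (λ y → s • b y) ⟩            ≈⟨ ⟨⟩-cong′ f ≈-refl (⟪⟫-∘ t s b) ⟨
        ⟨ x ∣[ f ] [ idᵖ ∣ f ] ⟪ s ⟫ ∘ᶠ b ⟩     ≈⟨ ⟨⟩-∘ᵗ id t x ⟪ s ⟫ b ⟩
        ⟨ ⟨ x ∣[ f ] b ⟩ ∣[ idᵖ ] ⟪ s ⟫ ⟩       ≈⟨ ⟨⟩-⟪⟫ _ s ⟩
        s • ⟨ x ∣[ f ] b ⟩                      ∎

    module _ {X Y} (f : X ⇀ Y) where
      private
        D = incl (! Y ∙ f) tt
        r = λ b → restrictᶠ (! Y) f b tt

      ∘-• : ∀ s x b → x ∘[ f ] (λ y → s • b y) ≈ s • (x ∘[ f ] b)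
      ∘-• s x b = begin
        x ∘[ f ] (λ y → s • b y)                             ≈⟨ ∘-fibrewise f x _ ⟩
        act D (⌜ x ⌝ tt ∘[ restrict (! Y) f tt ] r (λ y → s • b y))
          ≈⟨ act-congʳ D (≈-trans (∘-cong′ _ ≈-refl (restrictᶠ-• (! Y) f s b tt)) (∘-•ᵗ _ s _ (r b))) ⟩
        act D (s • (⌜ x ⌝ tt ∘[ restrict (! Y) f tt ] r b))  ≈⟨ act-• D s _ ⟩
        s • act D (⌜ x ⌝ tt ∘[ restrict (! Y) f tt ] r b)    ≈⟨ •-congʳ s (∘-fibrewise f x b) ⟨
        s • (x ∘[ f ] b)                                     ∎

      ⟨⟩-• : ∀ s x b → ⟨ x ∣[ f ] (λ y → s • b y) ⟩ ≈ s • ⟨ x ∣[ f ] b ⟩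
      ⟨⟩-• s x b = begin
        ⟨ x ∣[ f ] (λ y → s • b y) ⟩                               ≈⟨ ⟨⟩-fibrewise f x _ ⟩
        act i ⟨ act (D ᵗ) x ∣[ restrict (! Y) f tt ] r (λ y → s • b y) ⟩
          ≈⟨ act-congʳ i (≈-trans (⟨⟩-cong′ _ ≈-refl (restrictᶠ-• (! Y) f s b tt)) (⟨⟩-•ᵗ _ s _ (r b))) ⟩
        act i (s • ⟨ act (D ᵗ) x ∣[ restrict (! Y) f tt ] r b ⟩)   ≈⟨ act-• i s _ ⟩
        s • act i ⟨ act (D ᵗ) x ∣[ restrict (! Y) f tt ] r b ⟩     ≈⟨ •-congʳ s (⟨⟩-fibrewise f x b) ⟨
        s • ⟨ x ∣[ f ] b ⟩                                         ∎
        where i = incl (! Y) tt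

    commutativeMonoid : CommutativeMonoid a ℓ
    commutativeMonoid = record
      { Carrier = El [1]
      ; _≈_     = _≈_
      ; _∙_     = _•_
      ; ε       = 1#
      ; isCommutativeMonoid = record
        { isMonoid = record
          { isSemigroup = record
            { isMagma = record { isEquivalence = isEquivalence ; ∙-cong = •-cong }
            ; assoc   = λ s t u → ≈-sym (•-assoc s t u)
            }
          ; identity = •-identityˡ , •-identityʳ
          }
        ; comm = •-comm
        }
      }

-- Products over finite sets in the monoid A_[1], with complementary factors.
module Products {a ℓ} (A : GeneralizedRing a ℓ) (sa : SelfAdjoint A) where

  open GeneralizedRing A
  open Lemmas A

  private
    ∏Fin : ∀ n → (Fin n → El [1]) → El [1]
    ∏Fin zero    t = 1#
    ∏Fin (suc n) t = t zero • ∏Fin n (λ i → t (suc i))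

    coFin : ∀ n → (Fin n → El [1]) → Fin n → El [1]
    coFin (suc n) t zero    = ∏Fin n (λ i → t (suc i))
    coFin (suc n) t (suc i) = t zero • coFin n (λ i → t (suc i)) i

    coFin-∏ : ∀ n t i → coFin n t i • t i ≈ ∏Fin n t
    coFin-∏ (suc n) t zero    = •-comm sa _ _
    coFin-∏ (suc n) t (suc i) = ≈-trans (≈-sym (•-assoc _ _ _)) (•-congʳ _ (coFin-∏ n _ i))

    ∏Fin-closed : ∀ {p} (S : Pred (El [1]) p) → 1# ∈ S → (∀ {s t} → s ∈ S → t ∈ S → (s • t) ∈ S) →
                  ∀ n t → (∀ i → t i ∈ S) → ∏Fin n t ∈ S
    ∏Fin-closed S one mul zero    t ts = one
    ∏Fin-closed S one mul (suc n) t ts = mul (ts zero) (∏Fin-closed S one mul n _ (λ i → ts (suc i)))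

  module _ {Y : FinSet} (t : ∣ Y ∣ → El [1]) where

    private
      module e = Inverse (FinSet.finite Y)
      n = FinSet.size Y

    ∏ : El [1]
    ∏ = ∏Fin n (λ i → t (e.from i))

    cofactor : ∣ Y ∣ → El [1]
    cofactor y = coFin n (λ i → t (e.from i)) (e.to y)

    cofactor-∏ : ∀ y → cofactor y • t y ≈ ∏
    cofactor-∏ y = subst (λ y′ → cofactor y • t y′ ≈ ∏) (e.strictlyInverseʳ y) (coFin-∏ n _ (e.to y))

    ∏-closed : ∀ {p} (S : Pred (El [1]) p) → 1# ∈ S → (∀ {s t} → s ∈ S → t ∈ S → (s • t) ∈ S) →
               (∀ y → t y ∈ S) → ∏ ∈ S
    ∏-closed S one mul ts = ∏Fin-closed S one mul n _ (λ i → ts (e.from i))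

record MultiplicativeSet {a ℓ} (A : GeneralizedRing a ℓ) p : Set (a ⊔ ℓ ⊔ lsuc p) where
  no-eta-equality
  open GeneralizedRing A
  field
    member   : Pred (El [1]) p
    resp     : ∀ {s t} → s ≈ t → s ∈ member → t ∈ member
    1∈       : 1# ∈ member
    •-closed : ∀ {s t} → s ∈ member → t ∈ member → (s • t) ∈ member

module Localization {a ℓ p} (A : GeneralizedRing a ℓ) (sa : SelfAdjoint A)
                    (S : MultiplicativeSet A p) where

  open GeneralizedRing A
  open Lemmas A
  open Products A sa
  open MultiplicativeSet S
  open ≈-Reasoning
  open CommutativeMonoidSolver (commutativeMonoid sa) using (solve; _⊕_; _⊜_)

  Den : Set (a ⊔ p)
  Den = ∃ member

  _⊛_ : Den → Den → Den
  (s , s∈) ⊛ (t , t∈) = s • t , •-closed s∈ t∈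

  1ᴰ : Den
  1ᴰ = 1# , 1∈

  ∏ᴰ : ∀ {Y : FinSet} → (∣ Y ∣ → Den) → Den
  ∏ᴰ {Y} t = ∏ {Y} (λ y → proj₁ (t y)) , ∏-closed {Y} _ member 1∈ •-closed (λ y → proj₂ (t y))

  infix 6 _/_

  record Fraction (X : FinSet) : Set (a ⊔ p) where
    constructor _/_
    field
      num : El X
      den : Den

  open Fraction public

  denᴬ : ∀ {X} → Fraction X → El [1]
  denᴬ α = proj₁ (den α)

  infix 4 _≈ᴸ_
  record _≈ᴸ_ {X} (α β : Fraction X) : Set (a ⊔ ℓ ⊔ p) where
    constructor witness
    field
      factor   : El [1]
      factor∈  : factor ∈ member
      equality : factor • (denᴬ β • num α) ≈ factor • (denᴬ α • num β)

  -- β_y = commonNum_y / commonDen: the denominator is the product of all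
  -- denominators, and the numerators absorb the complementary factors.
  module _ {X Y} {f : X ⇀ Y} (β : ∀ y → Fraction (fib f y)) where

    commonDen : Den
    commonDen = ∏ᴰ {Y} (λ y → den (β y))

    commonNum : Fam f
    commonNum y = cofactor {Y} (λ y → denᴬ (β y)) y • num (β y)

  -- (x / s₁ , y / s₂) = (x , y) / (s₁ ∘ s₂) is well defined because A is
  -- self-adjoint, which makes ( , ) linear over A_[1] in its second argument.
  raw-S⁻¹A : RawGeneralizedRing (a ⊔ p) (a ⊔ ℓ ⊔ p)
  raw-S⁻¹A = record
    { El       = Fraction
    ; _≈_      = _≈ᴸ_
    ; 0#       = 0# / 1ᴰ
    ; 1#       = 1# / 1ᴰ
    ; act      = λ φ α → act φ (num α) / den α
    ; _∘[_]_   = λ α f β → num α ∘[ f ] commonNum β / den α ⊛ commonDen β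
    ; ⟨_∣[_]_⟩ = λ α f β → ⟨ num α ∣[ f ] commonNum β ⟩ / den α ⊛ commonDen β
    }

  private
    module L = RawGeneralizedRing raw-S⁻¹A

    refl′ : ∀ {X} {x : El X} → x ≈ x
    refl′ = ≈-refl

  flatten : ∀ {X} s t u (x : El X) → s • (t • (u • x)) ≈ (s • (t • u)) • x
  flatten s t u x = ≈-trans (•-congʳ s (•-assoc t u x)) (•-assoc s _ x)

  ≈ᴸ-refl : ∀ {X} {α : Fraction X} → α ≈ᴸ α
  ≈ᴸ-refl = witness 1# 1∈ ≈-refl

  ≈ᴸ-sym : ∀ {X} {α β : Fraction X} → α ≈ᴸ β → β ≈ᴸ α
  ≈ᴸ-sym (witness s s∈ e) = witness s s∈ (≈-sym e)

  ≈ᴸ-trans : ∀ {X} {α β γ : Fraction X} → α ≈ᴸ β → β ≈ᴸ γ → α ≈ᴸ γ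
  ≈ᴸ-trans {α = x / (s₁ , _)} {y / (s₂ , s₂∈)} {z / (s₃ , _)} (witness s s∈ e) (witness t t∈ e′) =
    witness ((s • t) • s₂) (•-closed (•-closed s∈ t∈) s₂∈) (begin
    ((s • t) • s₂) • (s₃ • x)   ≈⟨ •-assoc _ _ x ⟩
    (((s • t) • s₂) • s₃) • x
      ≈⟨ •-cong (solve 4 (λ s t s₂ s₃ → ((s ⊕ t) ⊕ s₂) ⊕ s₃ ⊜ (t ⊕ s₃) ⊕ (s ⊕ s₂)) refl′ s t s₂ s₃) refl′ ⟩
    ((t • s₃) • (s • s₂)) • x   ≈⟨ flatten _ s s₂ x ⟨
    (t • s₃) • (s • (s₂ • x))   ≈⟨ •-congʳ _ e ⟩
    (t • s₃) • (s • (s₁ • y))   ≈⟨ flatten _ s s₁ y ⟩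
    ((t • s₃) • (s • s₁)) • y
      ≈⟨ •-cong (solve 4 (λ s t s₁ s₃ → (t ⊕ s₃) ⊕ (s ⊕ s₁) ⊜ (s ⊕ s₁) ⊕ (t ⊕ s₃)) refl′ s t s₁ s₃) refl′ ⟩
    ((s • s₁) • (t • s₃)) • y   ≈⟨ flatten _ t s₃ y ⟨
    (s • s₁) • (t • (s₃ • y))   ≈⟨ •-congʳ _ e′ ⟩
    (s • s₁) • (t • (s₂ • z))   ≈⟨ flatten _ t s₂ z ⟩
    ((s • s₁) • (t • s₂)) • z
      ≈⟨ •-cong (solve 4 (λ s t s₁ s₂ → (s ⊕ s₁) ⊕ (t ⊕ s₂) ⊜ ((s ⊕ t) ⊕ s₂) ⊕ s₁) refl′ s t s₁ s₂) refl′ ⟩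
    (((s • t) • s₂) • s₁) • z   ≈⟨ •-assoc _ _ z ⟨
    ((s • t) • s₂) • (s₁ • z)   ∎)

  /-cong : ∀ {X} {x y : El X} {s t : Den} → x ≈ y → proj₁ s ≈ proj₁ t → x / s ≈ᴸ y / t
  /-cong e e′ = witness 1# 1∈ (•-congʳ 1# (•-cong (≈-sym e′) e))

  /-zero : ∀ {X} {x : El X} {s t : Den} → x ≈ 0# → x / s ≈ᴸ 0# / t
  /-zero e = witness 1# 1∈ (•-congʳ 1# (≈-trans (•-congʳ _ e) (≈-trans (•-0 _) (≈-sym (•-0 _)))))

  common : ∀ {X Y} {f : X ⇀ Y} (β : L.Fam f) y → β y ≈ᴸ commonNum β y / commonDen β
  common {Y = Y} β y = witness 1# 1∈ (•-congʳ 1# (begin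
    ∏ {Y} d • num (β y)                         ≈⟨ •-cong (cofactor-∏ {Y} d y) refl′ ⟨
    (cofactor {Y} d y • d y) • num (β y)        ≈⟨ •-cong (•-comm sa _ _) refl′ ⟩
    (d y • cofactor {Y} d y) • num (β y)        ≈⟨ •-assoc _ _ _ ⟨
    d y • (cofactor {Y} d y • num (β y))        ∎))
    where d = λ y → denᴬ (β y)

  -- Both operations are computed on numerators over any common denominator.
  module Bilinear {X Y U V} {f : X ⇀ Y} (op : El U → Fam f → El V)
    (op-cong : ∀ {x x′ b b′} → x ≈ x′ → b ≈ᶠ b′ → op x b ≈ op x′ b′)
    (op-•ˡ : ∀ s x b → op (s • x) b ≈ s • op x b)
    (op-•ʳ : ∀ s x b → op x (λ y → s • b y) ≈ s • op x b) where

    bilinear : ∀ s t x b → (s • t) • op x b ≈ op (s • x) (λ y → t • b y)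
    bilinear s t x b = ≈-sym (≈-trans (op-•ˡ s x _) (≈-trans (•-congʳ s (op-•ʳ t x b)) (•-assoc s t _)))

    op-frac : ∀ {α : Fraction U} {β : L.Fam f} {x s b t} → α ≈ᴸ x / s → (∀ y → β y ≈ᴸ b y / t) →
              op (num α) (commonNum β) / (den α ⊛ commonDen β) ≈ᴸ op x b / (s ⊛ t)
    op-frac {x₀ / (s₀ , _)} {β} {x} {s , _} {b} {t , _} (witness v v∈ e) e′ =
      witness (v • W) (•-closed v∈ (∏-closed {Y} w member 1∈ •-closed (λ y → _≈ᴸ_.factor∈ (e′ y)))) (begin
      (v • W) • ((s • t) • op x₀ b′)               ≈⟨ •-assoc _ _ _ ⟩
      ((v • W) • (s • t)) • op x₀ b′
        ≈⟨ •-cong (solve 4 (λ v W s t → (v ⊕ W) ⊕ (s ⊕ t) ⊜ (v ⊕ s) ⊕ (W ⊕ t)) refl′ v W s t) refl′ ⟩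
      ((v • s) • (W • t)) • op x₀ b′               ≈⟨ bilinear _ _ x₀ b′ ⟩
      op ((v • s) • x₀) (λ y → (W • t) • b′ y)
        ≈⟨ op-cong (≈-trans (≈-sym (•-assoc v s x₀)) (≈-trans e (•-assoc v s₀ x))) family ⟩
      op ((v • s₀) • x) (λ y → (W • T) • b y)      ≈⟨ bilinear _ _ x b ⟨
      ((v • s₀) • (W • T)) • op x b
        ≈⟨ •-cong (solve 4 (λ v W s t → (v ⊕ s) ⊕ (W ⊕ t) ⊜ (v ⊕ W) ⊕ (s ⊕ t)) refl′ v W s₀ T) refl′ ⟩
      ((v • W) • (s₀ • T)) • op x b                ≈⟨ •-assoc _ _ _ ⟨
      (v • W) • ((s₀ • T) • op x b)                ∎)
      where
      b′ = commonNum β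
      d  = λ y → denᴬ (β y)
      T  = ∏ {Y} d
      u  = cofactor {Y} d
      w  = λ y → _≈ᴸ_.factor (e′ y)
      W  = ∏ {Y} w
      z  = cofactor {Y} w
      family : ∀ y → (W • t) • b′ y ≈ (W • T) • b y
      family y = begin
        (W • t) • (u y • b₀)               ≈⟨ •-cong (•-cong (cofactor-∏ {Y} w y) refl′) refl′ ⟨
        ((z y • w y) • t) • (u y • b₀)     ≈⟨ •-assoc _ _ _ ⟩
        (((z y • w y) • t) • u y) • b₀
          ≈⟨ •-cong (solve 4 (λ z w t u → ((z ⊕ w) ⊕ t) ⊕ u ⊜ (z ⊕ u) ⊕ (w ⊕ t)) refl′ (z y) (w y) t (u y)) refl′ ⟩
        ((z y • u y) • (w y • t)) • b₀     ≈⟨ flatten _ _ _ _ ⟨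
        (z y • u y) • (w y • (t • b₀))     ≈⟨ •-congʳ _ (_≈ᴸ_.equality (e′ y)) ⟩
        (z y • u y) • (w y • (d y • b y))  ≈⟨ flatten _ _ _ _ ⟩
        ((z y • u y) • (w y • d y)) • b y
          ≈⟨ •-cong (solve 4 (λ z w d u → (z ⊕ u) ⊕ (w ⊕ d) ⊜ (z ⊕ w) ⊕ (u ⊕ d)) refl′ (z y) (w y) (d y) (u y)) refl′ ⟩
        ((z y • w y) • (u y • d y)) • b y
          ≈⟨ •-cong (•-cong (cofactor-∏ {Y} w y) (cofactor-∏ {Y} d y)) refl′ ⟩
        (W • T) • b y                      ∎
        where b₀ = num (β y)

  module _ {X Y} (f : X ⇀ Y) where
    private
      module ∘ = Bilinear {f = f} (_∘[ f ]_) (∘-cong′ f) (•-∘ f) (∘-• sa f)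
      module ⟨⟩ = Bilinear {f = f} (⟨_∣[ f ]_⟩) (⟨⟩-cong′ f) (•-⟨⟩ f) (⟨⟩-• sa f)

    ∘-frac : ∀ {α : Fraction Y} {β : L.Fam f} {x s b t} → α ≈ᴸ x / s → (∀ y → β y ≈ᴸ b y / t) →
             α L.∘[ f ] β ≈ᴸ x ∘[ f ] b / s ⊛ t
    ∘-frac {α} {β} {x} {s} {b} {t} = ∘.op-frac {α} {β} {x} {s} {b} {t}

    ⟨⟩-frac : ∀ {α : Fraction X} {β : L.Fam f} {x s b t} → α ≈ᴸ x / s → (∀ y → β y ≈ᴸ b y / t) →
              L.⟨ α ∣[ f ] β ⟩ ≈ᴸ ⟨ x ∣[ f ] b ⟩ / s ⊛ t
    ⟨⟩-frac {α} {β} {x} {s} {b} {t} = ⟨⟩.op-frac {α} {β} {x} {s} {b} {t}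

  act-frac : ∀ {X Y} (φ : X ⇌ Y) {α β : Fraction X} → α ≈ᴸ β → L.act φ α ≈ᴸ L.act φ β
  act-frac φ {α} {β} (witness s s∈ e) = witness s s∈ (begin
    s • (denᴬ β • act φ (num α))  ≈⟨ pull (denᴬ β) (num α) ⟨
    act φ (s • (denᴬ β • num α))  ≈⟨ act-congʳ φ e ⟩
    act φ (s • (denᴬ α • num β))  ≈⟨ pull (denᴬ α) (num β) ⟩
    s • (denᴬ α • act φ (num β))  ∎)
    where
    pull : ∀ t x → act φ (s • (t • x)) ≈ s • (t • act φ x)
    pull t x = ≈-trans (act-• φ s _) (•-congʳ s (act-• φ t x))

  restrict-frac : ∀ {X Y Z} (g : Y ⇀ Z) (f : X ⇀ Y) {β : L.Fam f} {b t} → (∀ y → β y ≈ᴸ b y / t) →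
                  ∀ z y → L.restrictᶠ g f β z y ≈ᴸ restrictᶠ g f b z y / t
  restrict-frac g f p z (y , e) = act-frac _ (act-frac _ (act-frac _ (p y)))

  ∘ᶠ-frac : ∀ {X Y Z} (g : Y ⇀ Z) (f : X ⇀ Y) {α : L.Fam g} {β : L.Fam f} {x s b t} →
            (∀ z → α z ≈ᴸ x z / s) → (∀ y → β y ≈ᴸ b y / t) →
            ∀ z → (L.[ g ∣ f ] α ∘ᶠ β) z ≈ᴸ ([ g ∣ f ] x ∘ᶠ b) z / s ⊛ t
  ∘ᶠ-frac g f {α} {β} {x} {s} {b} {t} p q z =
    ∘-frac (restrict g f z) {b = restrictᶠ g f b z} (p z) (restrict-frac g f {β} {b} q z)

  ⟨⟩ᶠ-frac : ∀ {X Y Z} (g : Y ⇀ Z) (f : X ⇀ Y) {α : L.Fam (g ∙ f)} {β : L.Fam f} {x s b t} →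
             (∀ z → α z ≈ᴸ x z / s) → (∀ y → β y ≈ᴸ b y / t) →
             ∀ z → L.[ g ∣ f ]⟨ α ∣ᶠ β ⟩ z ≈ᴸ [ g ∣ f ]⟨ x ∣ᶠ b ⟩ z / s ⊛ t
  ⟨⟩ᶠ-frac g f {α} {β} {x} {s} {b} {t} p q z =
    ⟨⟩-frac (restrict g f z) {b = restrictᶠ g f b z} (p z) (restrict-frac g f {β} {b} q z)

  recast-frac : ∀ {X Y} (f f′ : X ⇀ Y) {β : L.Fam f} {b t} → (∀ y → β y ≈ᴸ b y / t) →
                ∀ y → L.recast f f′ β y ≈ᴸ recast f f′ b y / t
  recast-frac f f′ p y = act-frac _ (act-frac _ (p y))

  module _ {X Y Z} (g : Z ⇀ Y) (f : X ⇀ Y) where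

    pull₁-frac : ∀ {β : L.Fam f} {b t} → (∀ y → β y ≈ᴸ b y / t) →
                 ∀ z → L.pull₁ g f β z ≈ᴸ pull₁ g f b z / t
    pull₁-frac {β} {b} {t} p z = aux (g · z) refl
      where
      aux : ∀ m e → L.pull₁At g f β m e ≈ᴸ pull₁At g f b m e / t
      aux nothing  e = /-zero refl′
      aux (just y) e = act-frac _ (p y)

    pull₂-frac : ∀ {β : L.Fam g} {b t} → (∀ y → β y ≈ᴸ b y / t) →
                 ∀ x → L.pull₂ g f β x ≈ᴸ pull₂ g f b x / t
    pull₂-frac {β} {b} {t} p x = aux (f · x) refl
      where
      aux : ∀ m e → L.pull₂At g f β m e ≈ᴸ pull₂At g f b m e / t
      aux nothing  e = /-zero refl′
      aux (just y) e = act-frac _ (p y)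

  infixr 4 _⨾_
  _⨾_ : ∀ {X} {α β γ : Fraction X} → α ≈ᴸ β → β ≈ᴸ γ → α ≈ᴸ γ
  _⨾_ = ≈ᴸ-trans

  isGeneralizedRing-S⁻¹A : IsGeneralizedRing raw-S⁻¹A
  isGeneralizedRing-S⁻¹A = record
    { isEquivalence = record { refl = ≈ᴸ-refl ; sym = ≈ᴸ-sym ; trans = ≈ᴸ-trans }
    ; act-cong = λ {_} {_} {φ} {ψ} e p → act-frac φ p ⨾ /-cong (act-cong e refl′) refl′
    ; act-id = λ α → /-cong (act-id _) refl′
    ; act-∙ = λ ψ φ α → /-cong (act-∙ ψ φ _) refl′
    ; act-0 = λ φ → /-cong (act-0 φ) refl′
    ; El-∅ = λ α → /-zero (El-∅ _)
    ; ∘-cong = λ {_} {_} {f} {f′} e {α} {α′} {β} {β′} p q →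
        /-cong (∘-cong e {b = commonNum β} refl′ (λ _ → refl′)) refl′
        ⨾ ≈ᴸ-sym (∘-frac f′ {b = recast f f′ (commonNum β)} (≈ᴸ-sym p)
            (λ y → ≈ᴸ-sym (q y) ⨾ recast-frac f f′ {b = commonNum β} (common β) y))
    ; ⟨⟩-cong = λ {_} {_} {f} {f′} e {α} {α′} {β} {β′} p q →
        /-cong (⟨⟩-cong e {b = commonNum β} refl′ (λ _ → refl′)) refl′
        ⨾ ≈ᴸ-sym (⟨⟩-frac f′ {b = recast f f′ (commonNum β)} (≈ᴸ-sym p)
            (λ y → ≈ᴸ-sym (q y) ⨾ recast-frac f f′ {b = commonNum β} (common β) y))
    ; ∘-zeroˡ = λ f β → /-zero (∘-zeroˡ f _)
    ; ∘-zeroʳ = λ f α → /-zero (≈-trans (∘-cong′ f refl′ (λ _ → •-0 _)) (∘-zeroʳ f _))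
    ; ⟨⟩-zeroˡ = λ f β → /-zero (⟨⟩-zeroˡ f _)
    ; ⟨⟩-zeroʳ = λ f α → /-zero (≈-trans (⟨⟩-cong′ f refl′ (λ _ → •-0 _)) (⟨⟩-zeroʳ f _))
    ; ∘-fibrewise = λ {_} {Y} f α β →
        /-cong (∘-fibrewise f (num α) (commonNum β)) refl′
        ⨾ act-frac _ (≈ᴸ-sym (∘ᶠ-frac (! Y) f {x = ⌜ num α ⌝} {b = commonNum β}
            (λ _ → ≈ᴸ-refl) (common β) tt))
    ; ⟨⟩-fibrewise = λ {_} {Y} f α β →
        /-cong (⟨⟩-fibrewise f (num α) (commonNum β)) refl′
        ⨾ act-frac _ (≈ᴸ-sym (⟨⟩ᶠ-frac (! Y) f {x = λ _ → act (incl (! Y ∙ f) tt ᵗ) (num α)}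
            {b = commonNum β} (λ _ → ≈ᴸ-refl) (common β) tt))
    ; ∘-assoc = λ h g f δ γ β w →
        let d = commonNum δ ; s = commonDen δ
            c = commonNum γ ; t = commonDen γ
            b = commonNum β ; u = commonDen β in
        recast-frac (h ∙ (g ∙ f)) ((h ∙ g) ∙ f) {b = [ h ∣ g ∙ f ] d ∘ᶠ ([ g ∣ f ] c ∘ᶠ b)}
          (∘ᶠ-frac h (g ∙ f) {x = d} {b = [ g ∣ f ] c ∘ᶠ b} (common δ)
            (∘ᶠ-frac g f {x = c} {b = b} (common γ) (common β))) w
        ⨾ /-cong (∘-assoc h g f d c b w) (•-assoc (proj₁ s) (proj₁ t) (proj₁ u))
        ⨾ ≈ᴸ-sym (∘ᶠ-frac (h ∙ g) f {x = [ h ∣ g ] d ∘ᶠ c} {b = b}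
            (∘ᶠ-frac h g {x = d} {b = c} (common δ) (common γ)) (common β) w)
    ; ⟨⟩-∘ = λ h g f δ α γ w →
        let d = commonNum δ ; s = commonDen δ
            a = commonNum α ; t = commonDen α
            c = commonNum γ ; u = commonDen γ
            k = h ∙ (g ∙ f) ; k′ = (h ∙ g) ∙ f in
        ⟨⟩ᶠ-frac h (g ∙ f) {x = d} {b = [ g ∣ f ] a ∘ᶠ c} (common δ)
          (∘ᶠ-frac g f {x = a} {b = c} (common α) (common γ)) w
        ⨾ /-cong (⟨⟩-∘ h g f d a c w)
            (solve 3 (λ s t u → s ⊕ (t ⊕ u) ⊜ (s ⊕ u) ⊕ t) refl′ (proj₁ s) (proj₁ t) (proj₁ u))
        ⨾ ≈ᴸ-sym (⟨⟩ᶠ-frac h g {x = [ h ∙ g ∣ f ]⟨ recast k k′ d ∣ᶠ c ⟩} {b = a}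
            (⟨⟩ᶠ-frac (h ∙ g) f {x = recast k k′ d} {b = c}
              (recast-frac k k′ {b = d} (common δ)) (common γ)) (common α) w)
    ; ∘-⟨⟩ = λ h g f δ γ α w →
        let d = commonNum δ ; s = commonDen δ
            c = commonNum γ ; t = commonDen γ
            a = commonNum α ; u = commonDen α
            k = h ∙ (g ∙ f) ; k′ = (h ∙ g) ∙ f in
        ⟨⟩ᶠ-frac h (g ∙ f) {x = recast k′ k ([ h ∙ g ∣ f ] d ∘ᶠ c)} {b = a}
          (recast-frac k′ k {b = [ h ∙ g ∣ f ] d ∘ᶠ c}
            (∘ᶠ-frac (h ∙ g) f {x = d} {b = c} (common δ) (common γ))) (common α) w
        ⨾ /-cong (∘-⟨⟩ h g f d c a w)
            (solve 3 (λ s t u → (s ⊕ t) ⊕ u ⊜ s ⊕ (u ⊕ t)) refl′ (proj₁ s) (proj₁ t) (proj₁ u))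
        ⨾ ≈ᴸ-sym (⟨⟩ᶠ-frac h g {x = d} {b = [ g ∣ f ]⟨ a ∣ᶠ c ⟩} (common δ)
            (⟨⟩ᶠ-frac g f {x = a} {b = c} (common α) (common γ)) w)
    ; ∘-⟨⟩-assoc = λ h g f δ α γ w →
        let d = commonNum δ ; s = commonDen δ
            a = commonNum α ; t = commonDen α
            c = commonNum γ ; u = commonDen γ
            k = h ∙ (g ∙ f) ; k′ = (h ∙ g) ∙ f in
        ⟨⟩ᶠ-frac (h ∙ g) f {x = recast k k′ ([ h ∣ g ∙ f ] d ∘ᶠ a)} {b = c}
          (recast-frac k k′ {b = [ h ∣ g ∙ f ] d ∘ᶠ a}
            (∘ᶠ-frac h (g ∙ f) {x = d} {b = a} (common δ) (common α))) (common γ) w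
        ⨾ /-cong (∘-⟨⟩-assoc h g f d a c w)
            (solve 3 (λ s t u → (s ⊕ t) ⊕ u ⊜ s ⊕ (t ⊕ u)) refl′ (proj₁ s) (proj₁ t) (proj₁ u))
        ⨾ ≈ᴸ-sym (∘ᶠ-frac h g {x = d} {b = [ g ∣ f ]⟨ a ∣ᶠ c ⟩} (common δ)
            (⟨⟩ᶠ-frac g f {x = a} {b = c} (common α) (common γ)) w)
    ; ⟨⟩-pull = λ h g f δ γ α w →
        let d = commonNum δ ; s = commonDen δ
            c = commonNum γ ; t = commonDen γ
            a = commonNum α ; u = commonDen α
            k = (h ∙ f) ∙ π₂ g f ; k′ = (h ∙ g) ∙ π₁ g f in
        ∘ᶠ-frac h g {x = [ h ∣ f ]⟨ d ∣ᶠ c ⟩} {b = a}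
          (⟨⟩ᶠ-frac h f {x = d} {b = c} (common δ) (common γ)) (common α) w
        ⨾ /-cong (⟨⟩-pull h g f d c a w)
            (solve 3 (λ s t u → (s ⊕ t) ⊕ u ⊜ (s ⊕ u) ⊕ t) refl′ (proj₁ s) (proj₁ t) (proj₁ u))
        ⨾ ≈ᴸ-sym (⟨⟩ᶠ-frac (h ∙ g) (π₁ g f)
            {x = recast k k′ ([ h ∙ f ∣ π₂ g f ] d ∘ᶠ pull₂ g f a)} {b = pull₁ g f c}
            (recast-frac k k′ {b = [ h ∙ f ∣ π₂ g f ] d ∘ᶠ pull₂ g f a}
              (∘ᶠ-frac (h ∙ f) (π₂ g f) {x = d} {b = pull₂ g f a} (common δ)
                (pull₂-frac g f {b = a} (common α))))
            (pull₁-frac g f {b = c} (common γ)) w)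
    ; ∘-identityʳ = λ f α y →
        ∘ᶠ-frac f idᵖ {x = commonNum α} {b = 1ᶠ idᵇ} (common α) (λ _ → ≈ᴸ-refl) y
        ⨾ /-cong (∘-identityʳ f (commonNum α) y) (•-identityʳ (proj₁ (commonDen α)))
        ⨾ ≈ᴸ-sym (common α y)
    ; ∘-identityˡ = λ f α y →
        recast-frac (idᵖ ∙ f) f {b = [ idᵖ ∣ f ] 1ᶠ idᵇ ∘ᶠ commonNum α}
          (∘ᶠ-frac idᵖ f {x = 1ᶠ idᵇ} {b = commonNum α} (λ _ → ≈ᴸ-refl) (common α)) y
        ⨾ /-cong (∘-identityˡ f (commonNum α) y) (•-identityˡ (proj₁ (commonDen α)))
        ⨾ ≈ᴸ-sym (common α y)
    ; ⟨⟩-identityʳ = λ f α y →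
        ⟨⟩ᶠ-frac f idᵖ {x = commonNum α} {b = 1ᶠ idᵇ} (common α) (λ _ → ≈ᴸ-refl) y
        ⨾ /-cong (⟨⟩-identityʳ f (commonNum α) y) (•-identityʳ (proj₁ (commonDen α)))
        ⨾ ≈ᴸ-sym (common α y)
    ; ∘-act = λ f α →
        ∘-frac (inv f) {x = num α} {s = den α} {b = 1ᶠ (f ᵗ)} ≈ᴸ-refl (λ _ → ≈ᴸ-refl)
        ⨾ /-cong (∘-act f (num α)) (•-identityʳ (denᴬ α))
    ; ⟨⟩-act = λ f α →
        ⟨⟩-frac (map f) {x = num α} {s = den α} {b = 1ᶠ f} ≈ᴸ-refl (λ _ → ≈ᴸ-refl)
        ⨾ /-cong (⟨⟩-act f (num α)) (•-identityʳ (denᴬ α))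
    }

  S⁻¹A : GeneralizedRing (a ⊔ p) (a ⊔ ℓ ⊔ p)
  S⁻¹A = record { raw = raw-S⁻¹A ; isGeneralizedRing = isGeneralizedRing-S⁻¹A }

module _ {a ℓ} (A : GeneralizedRing a ℓ) (sa : SelfAdjoint A) where

  open GeneralizedRing A
  open Lemmas A

  infix 20 _^_
  _^_ : El [1] → ℕ → El [1]
  s ^ zero  = 1#
  s ^ suc n = s • s ^ n

  powers : El [1] → MultiplicativeSet A ℓ
  powers s = record
    { member   = λ t → ∃[ n ] t ≈ s ^ n
    ; resp     = λ t≈u (n , e) → n , ≈-trans (≈-sym t≈u) e
    ; 1∈       = 0 , ≈-refl
    ; •-closed = λ (m , e) (n , e′) → m + n , ≈-trans (•-cong e e′) (^-+ m n)
    }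
    where
    ^-+ : ∀ m n → s ^ m • s ^ n ≈ s ^ (m + n)
    ^-+ zero    n = •-identityˡ _
    ^-+ (suc m) n = ≈-trans (≈-sym (•-assoc _ _ _)) (•-congʳ s (^-+ m n))

  complement : Spec A → MultiplicativeSet A ℓ
  complement 𝔭 .MultiplicativeSet.member s = s ∉ Spec.member 𝔭
  complement 𝔭 .MultiplicativeSet.resp e s∉ t∈ = s∉ (Spec.resp 𝔭 (≈-sym e) t∈)
  complement 𝔭 .MultiplicativeSet.1∈ = Spec.proper 𝔭
  complement 𝔭 .MultiplicativeSet.•-closed s∉ t∉ st∈ = [ s∉ , t∉ ]′ (Spec.prime 𝔭 st∈)

  absorb : ∀ 𝔭 s {t} → t ∈ Spec.member {A = A} 𝔭 → (s • t) ∈ Spec.member 𝔭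
  absorb 𝔭 s {t} t∈ = 𝔭.resp e (𝔭.closed s 1# (λ _ → t) (λ _ → t∈))
    where
    module 𝔭 = Spec 𝔭
    e : ⟨ s ∘[ idᵖ ] diag (λ _ → t) ∣[ ! [1] ] ⌜ 1# ⌝ ⟩ ≈ s • t
    e = ≈-trans (⟨⟩-cong′ (! [1]) (∘-cong′ idᵖ ≈-refl (λ _ → ≈-sym (⌜⌝-point t))) (λ z → ≈-sym (1ᶠ-⌜⌝ z)))
          (≈-trans (⟨⟩-act idᵇ (s • t)) (act-id (s • t)))

  module Loc (𝔭 : Spec A) = Localization A sa (complement 𝔭)

  Aₚ : Spec A → GeneralizedRing (a ⊔ ℓ) (a ⊔ ℓ)
  Aₚ 𝔭 = Localization.S⁻¹A A sa (complement 𝔭)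

  Aₛ : El [1] → GeneralizedRing (a ⊔ ℓ) (a ⊔ ℓ)
  Aₛ s = Localization.S⁻¹A A sa (powers s)

  module _ {u} (U : Open A u) where

    open Open U using (points)

    PreSection : FinSet → Set (lsuc 0ℓ ⊔ a ⊔ lsuc ℓ ⊔ u)
    PreSection X = ∀ 𝔭 → 𝔭 ∈ points → GeneralizedRing.El (Aₚ 𝔭) X

    -- Equal primes may be given by different predicates; f takes equal values
    -- there since U′ respects equality of primes.
    record IsFractionNear {X} (f : PreSection X) (𝔭 : Spec A) : Set (lsuc 0ℓ ⊔ lsuc a ⊔ lsuc ℓ ⊔ u) where
      field
        U′   : Open A (a ⊔ ℓ)
        𝔭∈U′ : 𝔭 ∈ Open.points U′
        U′⊆U : Open.points U′ ⊆ points
        num  : El X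
        den  : El [1]
        den∉ : ∀ 𝔮 → 𝔮 ∈ Open.points U′ → den ∉ Spec.member 𝔮
        value : ∀ 𝔮 (𝔮∈U′ : 𝔮 ∈ Open.points U′) (𝔮∈U : 𝔮 ∈ points) →
                Loc._≈ᴸ_ 𝔮 (f 𝔮 𝔮∈U) (Loc._/_ num (den , den∉ 𝔮 𝔮∈U′))

    record Section (X : FinSet) : Set (lsuc 0ℓ ⊔ lsuc a ⊔ lsuc ℓ ⊔ u) where
      field
        at              : PreSection X
        locallyFraction : ∀ 𝔭 → 𝔭 ∈ points → IsFractionNear at 𝔭

    open Section public

    record _≈ˢ_ {X} (f g : Section X) : Set (lsuc 0ℓ ⊔ lsuc a ⊔ lsuc ℓ ⊔ u) where
      field
        pointwise : ∀ 𝔭 𝔭∈U → Loc._≈ᴸ_ 𝔭 (at f 𝔭 𝔭∈U) (at g 𝔭 𝔭∈U)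

    open _≈ˢ_ public

    -- It suffices to give fractions on basic open sets D_x.
    record Basic {X} (f : PreSection X) (𝔭 : Spec A) : Set (lsuc 0ℓ ⊔ a ⊔ lsuc ℓ ⊔ u) where
      field
        centre : El [1]
        𝔭∌     : centre ∉ Spec.member 𝔭
        ⊆U     : ∀ 𝔮 → centre ∉ Spec.member 𝔮 → 𝔮 ∈ points
        num    : El X
        den    : El [1]
        den∉   : ∀ 𝔮 → centre ∉ Spec.member 𝔮 → den ∉ Spec.member 𝔮
        value  : ∀ 𝔮 (𝔮∌ : centre ∉ Spec.member 𝔮) (𝔮∈U : 𝔮 ∈ points) →
                 Loc._≈ᴸ_ 𝔮 (f 𝔮 𝔮∈U) (Loc._/_ num (den , den∉ 𝔮 𝔮∌))

    fromBasic : ∀ {X} {f : PreSection X} {𝔭} → Basic f 𝔭 → IsFractionNear f 𝔭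
    fromBasic B = record
      { U′    = record { points = V∁ A 𝔞 ; isOpen = 𝔞 , λ _ → mk⇔ id id }
      ; 𝔭∈U′  = centre , ≈-refl , 𝔭∌
      ; U′⊆U  = λ {𝔮} 𝔮∈ → ⊆U 𝔮 (out 𝔮 𝔮∈)
      ; num   = num
      ; den   = den
      ; den∉  = λ 𝔮 𝔮∈ → den∉ 𝔮 (out 𝔮 𝔮∈)
      ; value = λ 𝔮 𝔮∈ → value 𝔮 (out 𝔮 𝔮∈)
      }
      where
      open Basic B
      𝔞 : Pred (El [1]) ℓ
      𝔞 = centre ≈_
      out : ∀ 𝔮 → 𝔮 ∈ V∁ A 𝔞 → centre ∉ Spec.member 𝔮
      out 𝔮 (s , e , s∉) c∈ = s∉ (Spec.resp 𝔮 e c∈)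

    toBasic : ∀ {X} {f : PreSection X} {𝔭} → IsFractionNear f 𝔭 → Basic f 𝔭
    toBasic {𝔭 = 𝔭} N = record
      { centre = centre
      ; 𝔭∌     = proj₂ (proj₂ out)
      ; ⊆U     = λ 𝔮 𝔮∌ → U′⊆U (into 𝔮 𝔮∌)
      ; num    = num
      ; den    = den
      ; den∉   = λ 𝔮 𝔮∌ → den∉ 𝔮 (into 𝔮 𝔮∌)
      ; value  = λ 𝔮 𝔮∌ → value 𝔮 (into 𝔮 𝔮∌)
      }
      where
      open IsFractionNear N
      out : 𝔭 ∈ V∁ A (proj₁ (Open.isOpen U′))
      out = Equivalence.to (proj₂ (Open.isOpen U′) 𝔭) 𝔭∈U′
      centre = proj₁ out
      into : ∀ 𝔮 → centre ∉ Spec.member 𝔮 → 𝔮 ∈ Open.points U′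
      into 𝔮 𝔮∌ = Equivalence.from (proj₂ (Open.isOpen U′) 𝔮) (centre , proj₁ (proj₂ out) , 𝔮∌)

    private
      open Products A sa

      module Pointwise {X Y V W : FinSet} (f : X ⇀ Y) (op : El V → Fam f → El W) where

        opᴸ : ∀ 𝔮 → Loc.Fraction 𝔮 V → (∀ y → Loc.Fraction 𝔮 (fib f y)) → Loc.Fraction 𝔮 W
        opᴸ 𝔮 α β = Loc._/_ (op (Loc.num α) (Loc.commonNum 𝔮 {f = f} β))
                             (Loc._⊛_ 𝔮 (Loc.den α) (Loc.commonDen 𝔮 {f = f} β))

        module _ (opᴸ-cong : ∀ 𝔮 {α α′ β β′} → Loc._≈ᴸ_ 𝔮 α α′ → (∀ y → Loc._≈ᴸ_ 𝔮 (β y) (β′ y)) →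
                             Loc._≈ᴸ_ 𝔮 (opᴸ 𝔮 α β) (opᴸ 𝔮 α′ β′))
                 (σ : Section V) (τ : ∀ y → Section (fib f y)) where

          opˢ : Section W
          opˢ = record
            { at = λ 𝔭 𝔭∈ → opᴸ 𝔭 (at σ 𝔭 𝔭∈) (λ y → at (τ y) 𝔭 𝔭∈)
            ; locallyFraction = λ 𝔭 𝔭∈ → fromBasic (basic 𝔭 𝔭∈)
            }
            where
            basic : ∀ 𝔭 𝔭∈ → Basic (λ 𝔭 𝔭∈ → opᴸ 𝔭 (at σ 𝔭 𝔭∈) (λ y → at (τ y) 𝔭 𝔭∈)) 𝔭
            basic 𝔭 𝔭∈ = record
              { centre = s.centre • x
              ; 𝔭∌     = λ 𝔭∋ → [ s.𝔭∌ , x∉ ]′ (Spec.prime 𝔭 𝔭∋)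
              ; ⊆U     = λ 𝔮 𝔮∌ → s.⊆U 𝔮 (left 𝔮 𝔮∌)
              ; num    = op s.num (λ y → cofactor {Y} t.den y • t.num y)
              ; den    = s.den • ∏ {Y} t.den
              ; den∉   = λ 𝔮 𝔮∌ → proj₂ (Loc.den (frac 𝔮 𝔮∌))
              ; value  = λ 𝔮 𝔮∌ 𝔮∈ → opᴸ-cong 𝔮 (s.value 𝔮 (left 𝔮 𝔮∌) 𝔮∈) (λ y → t.value y 𝔮 (right 𝔮 𝔮∌ y) 𝔮∈)
              }
              where
              module s = Basic (toBasic (locallyFraction σ 𝔭 𝔭∈))
              module t y = Basic (toBasic (locallyFraction (τ y) 𝔭 𝔭∈))
              x : El [1]
              x = ∏ {Y} t.centre
              open MultiplicativeSet
              x∉ : x ∉ Spec.member 𝔭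
              x∉ = ∏-closed {Y} t.centre (member (complement 𝔭)) (1∈ (complement 𝔭))
                     (•-closed (complement 𝔭)) t.𝔭∌
              left : ∀ 𝔮 → (s.centre • x) ∉ Spec.member 𝔮 → s.centre ∉ Spec.member 𝔮
              left 𝔮 𝔮∌ 𝔮∋ = 𝔮∌ (Spec.resp 𝔮 (•-comm sa x s.centre) (absorb 𝔮 x 𝔮∋))
              right : ∀ 𝔮 → (s.centre • x) ∉ Spec.member 𝔮 → ∀ y → t.centre y ∉ Spec.member 𝔮
              right 𝔮 𝔮∌ y 𝔮∋ =
                𝔮∌ (absorb 𝔮 _ (Spec.resp 𝔮 (cofactor-∏ {Y} t.centre y) (absorb 𝔮 _ 𝔮∋)))
              frac : ∀ 𝔮 → (s.centre • x) ∉ Spec.member 𝔮 → Loc.Fraction 𝔮 W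
              frac 𝔮 𝔮∌ = opᴸ 𝔮 (Loc._/_ s.num (s.den , s.den∉ 𝔮 (left 𝔮 𝔮∌)))
                (λ y → Loc._/_ (t.num y) (t.den y , t.den∉ y 𝔮 (right 𝔮 𝔮∌ y)))

    fractionSection : ∀ {X} (x : El X) (s : El [1]) → (∀ 𝔭 → 𝔭 ∈ points → s ∉ Spec.member 𝔭) → Section X
    fractionSection x s s∉ = record
      { at = λ 𝔭 𝔭∈ → Loc._/_ x (s , s∉ 𝔭 𝔭∈)
      ; locallyFraction = λ 𝔭 𝔭∈ → record
        { U′    = record { points = V∁ A (proj₁ isOpen) ; isOpen = proj₁ isOpen , λ _ → mk⇔ id id }
        ; 𝔭∈U′  = Equivalence.to (proj₂ isOpen 𝔭) 𝔭∈
        ; U′⊆U  = λ {𝔮} 𝔮∈ → Equivalence.from (proj₂ isOpen 𝔮) 𝔮∈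
        ; num   = x
        ; den   = s
        ; den∉  = λ 𝔮 𝔮∈ → s∉ 𝔮 (Equivalence.from (proj₂ isOpen 𝔮) 𝔮∈)
        ; value = λ 𝔮 _ _ → Loc.witness 1# (Spec.proper 𝔮) ≈-refl
        }
      }
      where open Open U using (isOpen)

    private
      actˢ : ∀ {X Y} → X ⇌ Y → Section X → Section Y
      actˢ φ σ = record
        { at = λ 𝔭 𝔭∈ → GeneralizedRing.act (Aₚ 𝔭) φ (at σ 𝔭 𝔭∈)
        ; locallyFraction = λ 𝔭 𝔭∈ → let module N = IsFractionNear (locallyFraction σ 𝔭 𝔭∈) in record
          { U′    = N.U′
          ; 𝔭∈U′  = N.𝔭∈U′
          ; U′⊆U  = N.U′⊆U
          ; num   = act φ N.num
          ; den   = N.den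
          ; den∉  = N.den∉
          ; value = λ 𝔮 𝔮∈U′ 𝔮∈U → Loc.act-frac 𝔮 φ (N.value 𝔮 𝔮∈U′ 𝔮∈U)
          }
        }

    raw-𝒪 : RawGeneralizedRing (lsuc 0ℓ ⊔ lsuc a ⊔ lsuc ℓ ⊔ u) (lsuc 0ℓ ⊔ lsuc a ⊔ lsuc ℓ ⊔ u)
    raw-𝒪 = record
      { El       = Section
      ; _≈_      = _≈ˢ_
      ; 0#       = fractionSection 0# 1# (λ 𝔭 _ → Spec.proper 𝔭)
      ; 1#       = fractionSection 1# 1# (λ 𝔭 _ → Spec.proper 𝔭)
      ; act      = actˢ
      ; _∘[_]_   = λ {X} {Y} σ f τ → Pointwise.opˢ f (_∘[ f ]_)
          (λ 𝔮 p q → Lemmas.∘-cong′ (Aₚ 𝔮) f p q) σ τ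
      ; ⟨_∣[_]_⟩ = λ {X} {Y} σ f τ → Pointwise.opˢ f (⟨_∣[ f ]_⟩)
          (λ 𝔮 p q → Lemmas.⟨⟩-cong′ (Aₚ 𝔮) f p q) σ τ
      }

    private
      module 𝒪 = RawGeneralizedRing raw-𝒪
      module L (𝔭 : Spec A) = GeneralizedRing (Aₚ 𝔭)

      pw : ∀ {X} {σ τ : Section X} →
           (∀ 𝔭 𝔭∈ → Loc._≈ᴸ_ 𝔭 (at σ 𝔭 𝔭∈) (at τ 𝔭 𝔭∈)) → σ ≈ˢ τ
      pw p = record { pointwise = p }

      module _ (𝔭 : Spec A) (𝔭∈ : 𝔭 ∈ points) where

        ev : ∀ {X Y} {f : X ⇀ Y} → 𝒪.Fam f → L.Fam 𝔭 f
        ev β y = at (β y) 𝔭 𝔭∈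

        L-refl : ∀ {X} {α : L.El 𝔭 X} → Loc._≈ᴸ_ 𝔭 α α
        L-refl = Lemmas.≈-refl (Aₚ 𝔭)

        module _ {X Y Z} (g : Z ⇀ Y) (f : X ⇀ Y) where

          ev-pull₁ : ∀ β z → Loc._≈ᴸ_ 𝔭 (L.pull₁ 𝔭 g f (ev β) z) (ev {f = π₁ g f} (𝒪.pull₁ g f β) z)
          ev-pull₁ β z = aux (g · z) refl
            where
            aux : ∀ m e → Loc._≈ᴸ_ 𝔭 (L.pull₁At 𝔭 g f (ev β) m e) (at (𝒪.pull₁At g f β m e) 𝔭 𝔭∈)
            aux nothing  e = L-refl
            aux (just y) e = L-refl

          ev-pull₂ : ∀ β x → Loc._≈ᴸ_ 𝔭 (L.pull₂ 𝔭 g f (ev β) x) (ev {f = π₂ g f} (𝒪.pull₂ g f β) x)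
          ev-pull₂ β x = aux (f · x) refl
            where
            aux : ∀ m e → Loc._≈ᴸ_ 𝔭 (L.pull₂At 𝔭 g f (ev β) m e) (at (𝒪.pull₂At g f β m e) 𝔭 𝔭∈)
            aux nothing  e = L-refl
            aux (just y) e = L-refl

    isGeneralizedRing-𝒪 : IsGeneralizedRing raw-𝒪
    isGeneralizedRing-𝒪 = record
      { isEquivalence = record
        { refl  = pw λ 𝔭 _ → Lemmas.≈-refl (Aₚ 𝔭)
        ; sym   = λ p → pw λ 𝔭 𝔭∈ → Lemmas.≈-sym (Aₚ 𝔭) (pointwise p 𝔭 𝔭∈)
        ; trans = λ p q → pw λ 𝔭 𝔭∈ → Lemmas.≈-trans (Aₚ 𝔭) (pointwise p 𝔭 𝔭∈) (pointwise q 𝔭 𝔭∈)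
        }
      ; act-cong = λ e p → pw λ 𝔭 𝔭∈ → L.act-cong 𝔭 e (pointwise p 𝔭 𝔭∈)
      ; act-id   = λ σ → pw λ 𝔭 𝔭∈ → L.act-id 𝔭 (at σ 𝔭 𝔭∈)
      ; act-∙    = λ ψ φ σ → pw λ 𝔭 𝔭∈ → L.act-∙ 𝔭 ψ φ (at σ 𝔭 𝔭∈)
      ; act-0    = λ φ → pw λ 𝔭 _ → L.act-0 𝔭 φ
      ; El-∅     = λ σ → pw λ 𝔭 𝔭∈ → L.El-∅ 𝔭 (at σ 𝔭 𝔭∈)
      ; ∘-cong   = λ e p q → pw λ 𝔭 𝔭∈ → L.∘-cong 𝔭 e (pointwise p 𝔭 𝔭∈) (λ y → pointwise (q y) 𝔭 𝔭∈)
      ; ⟨⟩-cong  = λ e p q → pw λ 𝔭 𝔭∈ → L.⟨⟩-cong 𝔭 e (pointwise p 𝔭 𝔭∈) (λ y → pointwise (q y) 𝔭 𝔭∈)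
      ; ∘-zeroˡ  = λ f β → pw λ 𝔭 𝔭∈ → L.∘-zeroˡ 𝔭 f (ev 𝔭 𝔭∈ β)
      ; ∘-zeroʳ  = λ f α → pw λ 𝔭 𝔭∈ → L.∘-zeroʳ 𝔭 f (at α 𝔭 𝔭∈)
      ; ⟨⟩-zeroˡ = λ f β → pw λ 𝔭 𝔭∈ → L.⟨⟩-zeroˡ 𝔭 f (ev 𝔭 𝔭∈ β)
      ; ⟨⟩-zeroʳ = λ f α → pw λ 𝔭 𝔭∈ → L.⟨⟩-zeroʳ 𝔭 f (at α 𝔭 𝔭∈)
      ; ∘-fibrewise  = λ f α β → pw λ 𝔭 𝔭∈ → L.∘-fibrewise 𝔭 f (at α 𝔭 𝔭∈) (ev 𝔭 𝔭∈ β)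
      ; ⟨⟩-fibrewise = λ f α β → pw λ 𝔭 𝔭∈ → L.⟨⟩-fibrewise 𝔭 f (at α 𝔭 𝔭∈) (ev 𝔭 𝔭∈ β)
      ; ∘-assoc    = λ h g f δ γ β w → pw λ 𝔭 𝔭∈ →
          L.∘-assoc 𝔭 h g f (ev 𝔭 𝔭∈ δ) (ev 𝔭 𝔭∈ γ) (ev 𝔭 𝔭∈ β) w
      ; ⟨⟩-∘       = λ h g f δ α γ w → pw λ 𝔭 𝔭∈ →
          L.⟨⟩-∘ 𝔭 h g f (ev 𝔭 𝔭∈ δ) (ev 𝔭 𝔭∈ α) (ev 𝔭 𝔭∈ γ) w
      ; ∘-⟨⟩       = λ h g f δ γ α w → pw λ 𝔭 𝔭∈ →
          L.∘-⟨⟩ 𝔭 h g f (ev 𝔭 𝔭∈ δ) (ev 𝔭 𝔭∈ γ) (ev 𝔭 𝔭∈ α) w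
      ; ∘-⟨⟩-assoc = λ h g f δ α γ w → pw λ 𝔭 𝔭∈ →
          L.∘-⟨⟩-assoc 𝔭 h g f (ev 𝔭 𝔭∈ δ) (ev 𝔭 𝔭∈ α) (ev 𝔭 𝔭∈ γ) w
      ; ⟨⟩-pull    = λ h g f δ γ α w → pw λ 𝔭 𝔭∈ →
          let open Lemmas (Aₚ 𝔭) using () renaming
                (≈-trans to L-trans; ⟨⟩ᶠ-cong to L-⟨⟩ᶠ-cong; ∘ᶠ-cong to L-∘ᶠ-cong; recast-cong to L-recast-cong) in
          L-trans (L.⟨⟩-pull 𝔭 h g f (ev 𝔭 𝔭∈ δ) (ev 𝔭 𝔭∈ γ) (ev 𝔭 𝔭∈ α) w)
            (L-⟨⟩ᶠ-cong (h ∙ g) (π₁ g f)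
              (L-recast-cong ((h ∙ f) ∙ π₂ g f) ((h ∙ g) ∙ π₁ g f)
                (L-∘ᶠ-cong (h ∙ f) (π₂ g f) {ev 𝔭 𝔭∈ δ} (λ _ → L-refl 𝔭 𝔭∈) (ev-pull₂ 𝔭 𝔭∈ g f α)))
              (ev-pull₁ 𝔭 𝔭∈ g f γ) w)
      ; ∘-identityʳ  = λ f α y → pw λ 𝔭 𝔭∈ → L.∘-identityʳ 𝔭 f (ev 𝔭 𝔭∈ α) y
      ; ∘-identityˡ  = λ f α y → pw λ 𝔭 𝔭∈ → L.∘-identityˡ 𝔭 f (ev 𝔭 𝔭∈ α) y
      ; ⟨⟩-identityʳ = λ f α y → pw λ 𝔭 𝔭∈ → L.⟨⟩-identityʳ 𝔭 f (ev 𝔭 𝔭∈ α) y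
      ; ∘-act        = λ f α → pw λ 𝔭 𝔭∈ → L.∘-act 𝔭 f (at α 𝔭 𝔭∈)
      ; ⟨⟩-act       = λ f α → pw λ 𝔭 𝔭∈ → L.⟨⟩-act 𝔭 f (at α 𝔭 𝔭∈)
      }

    𝒪 : GeneralizedRing (lsuc 0ℓ ⊔ lsuc a ⊔ lsuc ℓ ⊔ u) (lsuc 0ℓ ⊔ lsuc a ⊔ lsuc ℓ ⊔ u)
    𝒪 = record { raw = raw-𝒪 ; isGeneralizedRing = isGeneralizedRing-𝒪 }

  ^-closed : ∀ (𝔭 : Spec A) s n → s ∉ Spec.member 𝔭 → s ^ n ∉ Spec.member 𝔭
  ^-closed 𝔭 s zero    s∉ = Spec.proper 𝔭
  ^-closed 𝔭 s (suc n) s∉ s^∈ = [ s∉ , ^-closed 𝔭 s n s∉ ]′ (Spec.prime 𝔭 s^∈)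

  -- a/sⁿ ↦ (𝔭 ↦ a/sⁿ); elements of {sⁿ} are t with a proof of t ≈ sⁿ.
  Ψ : ∀ s X → GeneralizedRing.El (Aₛ s) X → GeneralizedRing.El (𝒪 (basicOpen A s)) X
  Ψ s X (x Localization./ (t , n , t≈sⁿ)) =
    fractionSection (basicOpen A s) x t (λ 𝔭 s∉ t∈ → ^-closed 𝔭 s n s∉ (Spec.resp 𝔭 t≈sⁿ t∈))

  -- a ↦ (𝔭 ↦ a/1)
  Φ : ∀ X → El X → GeneralizedRing.El (𝒪 (spec A)) X
  Φ X x = fractionSection (spec A) x 1# (λ 𝔭 _ → Spec.proper 𝔭)

-- ExcludedMiddle from the library decides all types, hence includes choice of
-- witnesses.  Zorn's lemma is nevertheless stated apart: its usual derivation
-- needs choice functions that respect extensional equality of predicates.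
Zorn : ∀ c ℓ₁ ℓ₂ r → Set (lsuc (c ⊔ ℓ₁ ⊔ ℓ₂ ⊔ r))
Zorn c ℓ₁ ℓ₂ r = (P : Poset c ℓ₁ ℓ₂) → let open Poset P in
  (∀ (C : Pred Carrier r) → (∀ {x y} → x ∈ C → y ∈ C → x ≤ y ⊎ y ≤ x) →
     ∃[ u ] (∀ {x} → x ∈ C → x ≤ u)) →
  ∃[ m ] (∀ {x} → m ≤ x → x ≤ m)

{-# OPTIONS --safe #-}

-- For x, y ∈ A_X the t ∈ A_[1] with t x = t y form an h-ideal.  An h-ideal 𝔞
-- that no prime of D_s contains has a power of s as an element, since an h-ideal
-- maximal among those containing 𝔞 and avoiding the powers of s is prime.  Hence
-- elements of A_X that agree in every A_𝔭 with 𝔭 ∈ D_s agree after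
-- multiplication by some sⁿ, which is injectivity.  For surjectivity, the t for
-- which t σ is the section of an element of A_X form an h-ideal.  It is not
-- contained in any 𝔭 ∈ D_s: if σ = x / t near 𝔭, those e for which
-- g t σ = g x holds on D_e with some g ∉ 𝔭 also form an h-ideal; comparing the
-- fractions of σ near 𝔭 and near 𝔮 shows that it is not contained in any
-- 𝔮 ∈ D_s, so it contains a power of s, and g t σ = g x on D_s.  No finite cover
-- has to be chosen.
module Submission where

open import Axiom.ExcludedMiddle using (ExcludedMiddle)
open import Data.Product.Base using (_×_)
open import Defs

import Algebra.Solver.CommutativeMonoid as CommutativeMonoidSolver
open import Data.Fin.Base using (Fin; zero; suc)
open import Data.Nat.Base using (ℕ; zero; suc)
open import Data.Product.Base using (∃-syntax; _,_; proj₁; proj₂)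
open import Data.Sum.Base using (_⊎_; inj₁; inj₂)
open import Data.Unit.Base using (tt)
open import Function.Base using (id; case_of_)
open import Function.Bundles using (_⇔_; mk⇔; module Inverse; module Equivalence)
open import Function.Definitions using (Injective; Surjective)
open import Level using (Lift; lift; lower; _⊔_) renaming (suc to lsuc; zero to 0ℓ)
open import Relation.Binary.Bundles using (Poset)
open import Relation.Binary.PropositionalEquality.Core using (_≡_; refl; subst)
open import Relation.Nullary using (yes; no; contradiction)
open import Relation.Nullary.Decidable using (True; toWitness; fromWitness; decidable-stable)
open import Relation.Unary using (Pred; _∈_; _∉_; _⊆_)

-- Equalizers and colons as h-ideals.

module HIdeals {a ℓ} (A : GeneralizedRing a ℓ) (sa : SelfAdjoint A) where

  open GeneralizedRing A
  open Lemmas A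
  open Products A sa
  open ≈-Reasoning

  •-swap : ∀ {X} s t (x : El X) → s • (t • x) ≈ t • (s • x)
  •-swap s t x = begin
    s • (t • x)  ≈⟨ •-assoc s t x ⟩
    (s • t) • x  ≈⟨ •-cong (•-comm sa s t) ≈-refl ⟩
    (t • s) • x  ≈⟨ •-assoc t s x ⟨
    t • (s • x)  ∎

  -- (b ∘ x , d) for x a family of elements of A_W: both operations take place
  -- over the projections of W × X.
  combine : ∀ {X W} → El X → (∣ X ∣ → El W) → El X → El W
  combine {X} {W} b x d =
    ⟨ b ∘[ π₂ (! W) (! X) ] (λ i → pull₂ (! W) (! X) ⌜ x i ⌝ i) ∣[ π₁ (! W) (! X) ] pull₁ (! W) (! X) ⌜ d ⌝ ⟩

  module _ {X W : FinSet} (b d : El X) where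

    private
      f = π₂ (! W) (! X)

    combine-cong : ∀ {x y : ∣ X ∣ → El W} → (∀ i → x i ≈ y i) → combine b x d ≈ combine b y d
    combine-cong e = ⟨⟩-cong′ _
      (∘-cong′ f ≈-refl (λ i → act-congʳ (fib-π₂ (! W) (! X) refl) (⌜⌝-cong (e i) tt))) (λ _ → ≈-refl)

    pull-⌜•⌝ : ∀ s (x : El W) i → pull₂ (! W) (! X) ⌜ s • x ⌝ i ≈ s • pull₂ (! W) (! X) ⌜ x ⌝ i
    pull-⌜•⌝ s x i = ≈-trans (act-congʳ φ (act-• _ s x)) (act-• φ s _)
      where φ = fib-π₂ (! W) (! X) {x = i} refl

    combine-• : ∀ s (x : ∣ X ∣ → El W) → combine b (λ i → s • x i) d ≈ s • combine b x d
    combine-• s x = begin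
      combine b (λ i → s • x i) d
        ≈⟨ ⟨⟩-cong′ _ (∘-cong′ f ≈-refl (λ i → pull-⌜•⌝ s (x i) i)) (λ _ → ≈-refl) ⟩
      ⟨ b ∘[ f ] (λ i → s • pull₂ (! W) (! X) ⌜ x i ⌝ i) ∣[ π₁ (! W) (! X) ] pull₁ (! W) (! X) ⌜ d ⌝ ⟩
        ≈⟨ ⟨⟩-cong′ _ (∘-• sa f s b _) (λ _ → ≈-refl) ⟩
      ⟨ s • (b ∘[ f ] (λ i → pull₂ (! W) (! X) ⌜ x i ⌝ i)) ∣[ π₁ (! W) (! X) ] pull₁ (! W) (! X) ⌜ d ⌝ ⟩
        ≈⟨ •-⟨⟩ _ s _ _ ⟩
      s • combine b x d ∎

    -- Only `c i` enters over `i`, so `diag c` may be replaced there by the constant family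
    -- `⟪ c i ⟫`, for which the law is `⟪⟫-∘`.
    diag-∘ : ∀ {Y} (t : ∣ Y ∣ → ∣ X ∣) (c : ∣ X ∣ → El [1]) (y : Fam (total {Y} {X} t)) →
             [ idᵖ ∣ total {Y} {X} t ] diag c ∘ᶠ y ≈ᶠ λ i → c i • y i
    diag-∘ {Y} t c y i = ≈-trans (∘-cong′ _ (≈-sym (⟪⟫-point (c i) i)) (λ _ → ≈-refl)) (⟪⟫-∘ {Y} {X} t (c i) y i)

    -- The base change law `⟨⟩-pullᵗ` moves the contraction outside; by associativity `diag c` then
    -- multiplies the copy of `y` over each `i`.
    combine-action : ∀ c (y : El W) →
      ⟨ b ∘[ idᵖ ] diag c ∣[ ! X ] ⌜ d ⌝ ⟩ • y ≈ combine b (λ i → c i • y) d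
    combine-action c y = begin
      ⟨ b ∘[ idᵖ ] diag c ∣[ ! X ] ⌜ d ⌝ ⟩ • y
        ≈⟨ ⟨⟩-pullᵗ {X} {[1]} {W} _ _ (b ∘[ idᵖ ] diag c) ⌜ d ⌝ ⌜ y ⌝ ⟩
      ⟨ (b ∘[ idᵖ ] diag c) ∘[ f ] pull₂ (! W) (! X) ⌜ y ⌝ ∣[ π₁ (! W) (! X) ] pull₁ (! W) (! X) ⌜ d ⌝ ⟩
        ≈⟨ ⟨⟩-cong′ _ family (λ _ → ≈-refl) ⟩
      combine b (λ i → c i • y) d ∎
      where
      family : (b ∘[ idᵖ ] diag c) ∘[ f ] pull₂ (! W) (! X) ⌜ y ⌝ ≈
               b ∘[ f ] (λ i → pull₂ (! W) (! X) ⌜ c i • y ⌝ i)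
      family = begin
        (b ∘[ idᵖ ] diag c) ∘[ f ] pull₂ (! W) (! X) ⌜ y ⌝
          ≈⟨ ∘-assocᵗ {pullback (! W) (! X)} id (λ ((_ , i) , _) → i) b (diag c) _ ⟨
        b ∘[ f ] ([ idᵖ ∣ f ] diag c ∘ᶠ pull₂ (! W) (! X) ⌜ y ⌝)
          ≈⟨ ∘-cong′ f ≈-refl (λ i → ≈-trans (diag-∘ {pullback (! W) (! X)} _ c _ i) (≈-sym (pull-⌜•⌝ (c i) y i))) ⟩
        b ∘[ f ] (λ i → pull₂ (! W) (! X) ⌜ c i • y ⌝ i) ∎

  cofactor-• : ∀ {X W} (w : ∣ X ∣ → El [1]) i (x : El W) → cofactor {X} w i • (w i • x) ≈ ∏ {X} w • x
  cofactor-• {X} w i x = ≈-trans (•-assoc _ _ x) (•-cong (cofactor-∏ {X} w i) ≈-refl)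

  -- Trades the separate factors `w i` for a single one, which `combine-•` can move through
  -- `combine`.
  ∏-equalizes : ∀ {X W} (w : ∣ X ∣ → El [1]) {x y : ∣ X ∣ → El W} →
              (∀ i → w i • x i ≈ w i • y i) → ∀ i → ∏ {X} w • x i ≈ ∏ {X} w • y i
  ∏-equalizes {X} w {x} {y} e i = begin
    ∏ {X} w • x i                   ≈⟨ cofactor-• {X} w i (x i) ⟨
    cofactor {X} w i • (w i • x i)  ≈⟨ •-congʳ _ (e i) ⟩
    cofactor {X} w i • (w i • y i)  ≈⟨ cofactor-• {X} w i (y i) ⟩
    ∏ {X} w • y i                   ∎

  equalizer : ∀ {X} → El X → El X → Pred (El [1]) ℓ
  equalizer x y t = t • x ≈ t • y

  -- By `combine-action`, (b ∘ c , d) acts on `x` only through the elements `c i • x`, and these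
  -- equal `c i • y`.
  equalizer-isHIdeal : ∀ {X} (x y : El X) → IsHIdeal A (equalizer x y)
  equalizer-isHIdeal x y = record
    { resp   = λ e p → ≈-trans (•-cong (≈-sym e) ≈-refl) (≈-trans p (•-cong e ≈-refl))
    ; closed = λ b d c cs → begin
        ⟨ b ∘[ idᵖ ] diag c ∣[ ! _ ] ⌜ d ⌝ ⟩ • x  ≈⟨ combine-action b d c x ⟩
        combine b (λ i → c i • x) d               ≈⟨ combine-cong b d cs ⟩
        combine b (λ i → c i • y) d               ≈⟨ combine-action b d c y ⟨
        ⟨ b ∘[ idᵖ ] diag c ∣[ ! _ ] ⌜ d ⌝ ⟩ • y  ∎
    }

  module _ {p} {𝔞 : Pred (El [1]) p} (isHIdeal : IsHIdeal A 𝔞) where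

    open IsHIdeal isHIdeal

    -- The closure property over `[1]` with `d` the unit: contraction with 1 is the identity, so
    -- only the product remains.
    •-absorbs : ∀ s {t} → t ∈ 𝔞 → (s • t) ∈ 𝔞
    •-absorbs s {t} t∈ = resp e (closed s 1# (λ _ → t) (λ _ → t∈))
      where
      e : ⟨ s ∘[ idᵖ ] diag (λ _ → t) ∣[ ! [1] ] ⌜ 1# ⌝ ⟩ ≈ s • t
      e = begin
        ⟨ s ∘[ idᵖ ] diag (λ _ → t) ∣[ ! [1] ] ⌜ 1# ⌝ ⟩
          ≈⟨ ⟨⟩-cong′ (! [1]) (∘-cong′ idᵖ ≈-refl (λ _ → ⌜⌝-point t)) 1ᶠ-⌜⌝ ⟨
        ⟨ s • t ∣[ ! [1] ] 1ᶠ idᵇ ⟩  ≈⟨ ⟨⟩-act idᵇ (s • t) ⟩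
        act idᵇ (s • t)              ≈⟨ act-id (s • t) ⟩
        s • t                        ∎

    colon : El [1] → Pred (El [1]) p
    colon v t = (v • t) ∈ 𝔞

    -- The factor `v` passes out of (b ∘ c , d); taking it out of the family `c` is `∘-•`, which
    -- rests on self-adjointness.
    colon-isHIdeal : ∀ v → IsHIdeal A (colon v)
    colon-isHIdeal v = record
      { resp   = λ e → resp (•-congʳ v e)
      ; closed = λ b d c cs → resp (e b d c) (closed b d (λ i → v • c i) cs)
      }
      where
      e : ∀ {X} (b d : El X) (c : ∣ X ∣ → El [1]) →
          ⟨ b ∘[ idᵖ ] diag (λ i → v • c i) ∣[ ! X ] ⌜ d ⌝ ⟩ ≈ v • ⟨ b ∘[ idᵖ ] diag c ∣[ ! X ] ⌜ d ⌝ ⟩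
      e {X} b d c = begin
        ⟨ b ∘[ idᵖ ] diag (λ i → v • c i) ∣[ ! X ] ⌜ d ⌝ ⟩
          ≈⟨ ⟨⟩-cong′ (! X) (∘-cong′ idᵖ ≈-refl (λ i → act-• (point {fib (idᵖ {X}) i} (i , refl)) v (c i))) (λ _ → ≈-refl) ⟩
        ⟨ b ∘[ idᵖ ] (λ i → v • diag c i) ∣[ ! X ] ⌜ d ⌝ ⟩
          ≈⟨ ⟨⟩-cong′ (! X) (∘-• sa idᵖ v b (diag c)) (λ _ → ≈-refl) ⟩
        ⟨ v • (b ∘[ idᵖ ] diag c) ∣[ ! X ] ⌜ d ⌝ ⟩  ≈⟨ •-⟨⟩ (! X) v _ _ ⟩
        v • ⟨ b ∘[ idᵖ ] diag c ∣[ ! X ] ⌜ d ⌝ ⟩    ∎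

-- Primes from Zorn's lemma.

module Classical (em : ∀ {ℓ} → ExcludedMiddle ℓ)
                 (zorn : ∀ {c ℓ₁ ℓ₂ r} → Zorn c ℓ₁ ℓ₂ r) where

  -- Decidability makes every proposition equivalent to one in the lowest
  -- universe; h-ideals defined by quantifying over Spec thereby fit Spec.member.
  Resize : ∀ {p} q → Set p → Set q
  Resize q P = Lift q (True (em {P = P}))

  resize : ∀ {p q} {P : Set p} → P → Resize q P
  resize x = lift (fromWitness x)

  unresize : ∀ {p q} {P : Set p} → Resize q P → P
  unresize x = toWitness (lower x)

  module _ {a ℓ} (A : GeneralizedRing a ℓ) (sa : SelfAdjoint A) where

    open GeneralizedRing A
    open Lemmas A
    open HIdeals A sa

    module _ {p q} {𝔞 : Pred (El [1]) p} (𝔞-isHIdeal : IsHIdeal A 𝔞) (S : MultiplicativeSet A q)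
             (disjoint : ∀ {t} → t ∈ MultiplicativeSet.member S → t ∉ 𝔞) where

      private
        module S = MultiplicativeSet S

        record Avoiding : Set (lsuc 0ℓ ⊔ a ⊔ lsuc ℓ ⊔ p ⊔ q) where
          field
            member   : Pred (El [1]) ℓ
            isHIdeal : IsHIdeal A member
            contains : 𝔞 ⊆ member
            avoids   : ∀ {t} → t ∈ S.member → t ∉ member

          open IsHIdeal isHIdeal public

        open Avoiding

        infix 4 _≼_
        _≼_ : Avoiding → Avoiding → Set (a ⊔ ℓ)
        I ≼ J = member I ⊆ member J

        inclusion : Poset (lsuc 0ℓ ⊔ a ⊔ lsuc ℓ ⊔ p ⊔ q) (a ⊔ ℓ) (a ⊔ ℓ)
        inclusion = record
          { Carrier = Avoiding
          ; _≈_     = λ I J → I ≼ J × J ≼ I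
          ; _≤_     = _≼_
          ; isPartialOrder = record
            { isPreorder = record
              { isEquivalence = record
                { refl  = id , id
                ; sym   = λ (i , j) → j , i
                ; trans = λ (i , j) (i′ , j′) → (λ x → i′ (i x)) , (λ x → j (j′ x))
                }
              ; reflexive = proj₁
              ; trans     = λ i j x → j (i x)
              }
            ; antisym = λ i j → i , j
            }
          }

        base : Avoiding
        base = record
          { member   = λ t → Resize ℓ (t ∈ 𝔞)
          ; isHIdeal = record
            { resp   = λ e t∈ → resize (IsHIdeal.resp 𝔞-isHIdeal e (unresize t∈))
            ; closed = λ b d c cs → resize (IsHIdeal.closed 𝔞-isHIdeal b d c (λ i → unresize (cs i)))
            }
          ; contains = resize
          ; avoids   = λ t∈S t∈ → disjoint t∈S (unresize t∈)
          }

        base-least : ∀ I → base ≼ I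
        base-least I t∈ = contains I (unresize t∈)

        module _ {r} (C : Pred Avoiding r) (chain : ∀ {I J} → I ∈ C → J ∈ C → I ≼ J ⊎ J ≼ I) where

          -- Adjoining the least element `base` preserves the chain property and makes the union
          -- contain 𝔞 even if `C` is empty.
          Link : Pred Avoiding _
          Link I = I ∈ C ⊎ I ≡ base

          total-Link : ∀ {I J} → I ∈ Link → J ∈ Link → I ≼ J ⊎ J ≼ I
          total-Link (inj₁ I∈)  (inj₁ J∈)      = chain I∈ J∈
          total-Link {J = J} (inj₂ refl) _     = inj₁ (base-least J)
          total-Link {I} (inj₁ _) (inj₂ refl)  = inj₂ (base-least I)

          -- The closure property of `union` draws one h-ideal for each element of a finite set, so
          -- it suffices that one link lies above them all. `base` bounds the empty family.
          boundFin : ∀ n (J : Fin n → Avoiding) → (∀ i → J i ∈ Link) →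
                     ∃[ K ] (K ∈ Link × ∀ i → J i ≼ K)
          boundFin zero    J J∈ = base , inj₂ refl , λ ()
          boundFin (suc n) J J∈ with boundFin n (λ i → J (suc i)) (λ i → J∈ (suc i))
          ... | K , K∈ , ≼K with total-Link (J∈ zero) K∈
          ...   | inj₁ J≼K = K , K∈ , λ { zero → J≼K ; (suc i) → ≼K i }
          ...   | inj₂ K≼J = J zero , J∈ zero , λ { zero → id ; (suc i) t∈ → K≼J (≼K i t∈) }

          bound : ∀ {X} (J : ∣ X ∣ → Avoiding) → (∀ x → J x ∈ Link) →
                  ∃[ K ] (K ∈ Link × ∀ x → J x ≼ K)
          bound {X} J J∈ with boundFin (FinSet.size X) (λ i → J (e.from i)) (λ i → J∈ (e.from i))
            where module e = Inverse (FinSet.finite X)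
          ... | K , K∈ , ≼K = K , K∈ , λ x → subst (λ x → J x ≼ K) (e.strictlyInverseʳ x) (≼K (e.to x))
            where module e = Inverse (FinSet.finite X)

          union : Avoiding
          union = record
            { member   = λ t → Resize ℓ (∃[ I ] (I ∈ Link × t ∈ member I))
            ; isHIdeal = record
              { resp   = λ e t∈ → let I , I∈ , t∈I = unresize t∈ in resize (I , I∈ , resp I e t∈I)
              ; closed = λ {X} b d c cs →
                  let K , K∈ , ≼K = bound {X} (λ x → proj₁ (unresize (cs x))) (λ x → proj₁ (proj₂ (unresize (cs x))))
                  in resize (K , K∈ , closed K b d c (λ x → ≼K x (proj₂ (proj₂ (unresize (cs x))))))
              }
            ; contains = λ t∈ → resize (base , inj₂ refl , resize t∈)
            ; avoids   = λ t∈S t∈ → let I , _ , t∈I = unresize t∈ in avoids I t∈S t∈I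
            }

          union-upper : ∀ {I} → I ∈ C → I ≼ union
          union-upper {I} I∈ t∈ = resize (I , inj₁ I∈ , t∈)

        module _ (M : Avoiding) (maximal : ∀ {I} → M ≼ I → I ≼ M) where

          -- As M ⊆ (M : v) always holds, a colon that avoids S lies above M in the order, and
          -- maximality applies.
          maximal-colon : ∀ v → (∀ {t} → t ∈ S.member → t ∉ colon (isHIdeal M) v) → colon (isHIdeal M) v ⊆ member M
          maximal-colon v avoids′ = maximal {record
            { member   = colon (isHIdeal M) v
            ; isHIdeal = colon-isHIdeal (isHIdeal M) v
            ; contains = λ t∈ → •-absorbs (isHIdeal M) v (contains M t∈)
            ; avoids   = avoids′
            }} (•-absorbs (isHIdeal M) v)

          -- If (M : u) does not meet S, it is M and contains v; otherwise u • t ∈ M for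
          -- some t ∈ S, and (M : t), which does not meet S, is M and contains u.
          maximal-prime : ∀ {u v} → (u • v) ∈ member M → u ∈ member M ⊎ v ∈ member M
          maximal-prime {u} {v} uv∈ with em {P = ∃[ t ] (t ∈ S.member × t ∈ colon (isHIdeal M) u)}
          ... | no none = inj₂ (maximal-colon u (λ t∈S t∈ → none (_ , t∈S , t∈)) uv∈)
          ... | yes (t , t∈S , ut∈) = inj₁ (maximal-colon t (λ r∈S → avoids M (S.•-closed t∈S r∈S))
                                             (resp M (•-comm sa u t) ut∈))

      prime-avoiding : ∃[ 𝔭 ] (𝔞 ⊆ Spec.member {A = A} 𝔭 × ∀ {t} → t ∈ S.member → t ∉ Spec.member 𝔭)
      -- Any level would do for the chains, since `union` resizes its membership predicate to ℓ.
      prime-avoiding with zorn {r = 0ℓ} inclusion (λ C chain → union C chain , λ {I} → union-upper C chain {I})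
      ... | M , maximal = record
        { member   = member M
        ; isHIdeal = isHIdeal M
        ; proper   = avoids M S.1∈
        ; prime    = maximal-prime M (λ {I} → maximal {I})
        } , contains M , avoids M

    -- Takes the place of quasi-compactness of D_s: a property witnessed at each prime of D_s by an
    -- element of 𝔞 outside that prime is witnessed by a single power of `s`.
    power-in : ∀ {p} {𝔞 : Pred (El [1]) p} → IsHIdeal A 𝔞 → ∀ s →
               (∀ 𝔭 → s ∉ Spec.member {A = A} 𝔭 → ∃[ t ] (t ∈ 𝔞 × t ∉ Spec.member 𝔭)) →
               ∃[ n ] _^_ A sa s n ∈ 𝔞
    power-in {𝔞 = 𝔞} isHIdeal s escapes with em {P = ∃[ n ] _^_ A sa s n ∈ 𝔞}
    ... | yes s^∈ = s^∈
    ... | no none with prime-avoiding isHIdeal (powers A sa s)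
                         (λ (n , e) t∈ → none (n , IsHIdeal.resp isHIdeal e t∈))
    ...   | 𝔭 , 𝔞⊆𝔭 , avoids with escapes 𝔭 (avoids (1 , ≈-sym (•-identityʳ s)))
    ...     | t , t∈𝔞 , t∉𝔭 = contradiction (𝔞⊆𝔭 t∈𝔞) t∉𝔭

    -- Equality and clearing of denominators at primes.

    open CommutativeMonoidSolver (commutativeMonoid sa) using (solve; _⊕_; _⊜_)
    open Products A sa
    open ≈-Reasoning

    private
      module L (𝔭 : Spec A) = Localization A sa (complement A sa 𝔭)

      infix 20 _↑_
      _↑_ : El [1] → ℕ → El [1]
      _↑_ = _^_ A sa

    •-^ : ∀ s t n → (s • t) ↑ n ≈ s ↑ n • t ↑ n
    •-^ s t zero    = ≈-sym (•-identityˡ 1#)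
    •-^ s t (suc n) = ≈-trans (•-congʳ _ (•-^ s t n))
      (solve 4 (λ s t u v → (s ⊕ t) ⊕ (u ⊕ v) ⊜ (s ⊕ u) ⊕ (t ⊕ v)) ≈-refl s t (s ↑ n) (t ↑ n))

    -- Each local factor `w` is an element of the h-ideal `equalizer x y` outside 𝔭.
    equal-after-power : ∀ {X} s {x y : El X} →
      (∀ 𝔭 → s ∉ Spec.member {A = A} 𝔭 → ∃[ w ] (w ∉ Spec.member 𝔭 × w • x ≈ w • y)) →
      ∃[ n ] s ↑ n • x ≈ s ↑ n • y
    equal-after-power s {x} {y} locally = power-in (equalizer-isHIdeal x y) s
      (λ 𝔭 s∉ → let w , w∉ , e = locally 𝔭 s∉ in w , e , w∉)

    -- The relation t α = x / 1.
    record Clears {X} (𝔭 : Spec A) (α : L.Fraction 𝔭 X) (t : El [1]) (x : El X) : Set (a ⊔ ℓ) where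
      constructor clearing
      field
        factor   : El [1]
        factor∉  : factor ∉ Spec.member 𝔭
        equality : factor • (t • L.num α) ≈ factor • (L.denᴬ 𝔭 α • x)

    module _ {X : FinSet} (𝔭 : Spec A) {α : L.Fraction 𝔭 X} where

      private
        y = L.num α
        u = L.denᴬ 𝔭 α

      clears-cong : ∀ {t t′ x x′} → t ≈ t′ → x ≈ x′ → Clears 𝔭 α t x → Clears 𝔭 α t′ x′
      clears-cong e e′ (clearing w w∉ p) = clearing w w∉
        (≈-trans (•-congʳ w (•-cong (≈-sym e) ≈-refl)) (≈-trans p (•-congʳ w (•-congʳ u e′))))

      clears-• : ∀ s {t x} → Clears 𝔭 α t x → Clears 𝔭 α (s • t) (s • x)
      clears-• s {t} {x} (clearing w w∉ p) = clearing w w∉ (begin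
        w • ((s • t) • y)  ≈⟨ •-congʳ w (•-assoc s t y) ⟨
        w • (s • (t • y))  ≈⟨ •-swap w s _ ⟩
        s • (w • (t • y))  ≈⟨ •-congʳ s p ⟩
        s • (w • (u • x))  ≈⟨ •-swap s w _ ⟩
        w • (s • (u • x))  ≈⟨ •-congʳ w (•-swap s u x) ⟩
        w • (u • (s • x))  ∎)

      clears-≈ : ∀ {x t} {t∉ : t ∉ Spec.member 𝔭} → Clears 𝔭 α t x → L._≈ᴸ_ 𝔭 α (x L./ (t , t∉))
      clears-≈ (clearing w w∉ p) = L.witness w w∉ p

      ≈-clears : ∀ {x t} {t∉ : t ∉ Spec.member 𝔭} → L._≈ᴸ_ 𝔭 α (x L./ (t , t∉)) → Clears 𝔭 α t x
      ≈-clears (L.witness w w∉ p) = clearing w w∉ p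

      -- `x` and `x′` have the same image in A_𝔭, which is all that the relation sees.
      clears-equal : ∀ {t x x′ w} → w ∉ Spec.member 𝔭 → w • x ≈ w • x′ → Clears 𝔭 α t x → Clears 𝔭 α t x′
      clears-equal {t} {x} {x′} {w} w∉ e (clearing v v∉ p) =
        clearing (w • v) (MultiplicativeSet.•-closed (complement A sa 𝔭) w∉ v∉) (begin
        (w • v) • (t • y)   ≈⟨ •-assoc w v _ ⟨
        w • (v • (t • y))   ≈⟨ •-congʳ w p ⟩
        w • (v • (u • x))   ≈⟨ move x ⟩
        v • (u • (w • x))   ≈⟨ •-congʳ v (•-congʳ u e) ⟩
        v • (u • (w • x′))  ≈⟨ move x′ ⟨
        w • (v • (u • x′))  ≈⟨ •-assoc w v _ ⟩
        (w • v) • (u • x′)  ∎)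
        where
        move : ∀ z → w • (v • (u • z)) ≈ v • (u • (w • z))
        move z = ≈-trans (•-swap w v _) (•-congʳ v (•-swap w u z))

      -- `s` is invertible in A_𝔭 and is absorbed into the factor.
      clears-cancel : ∀ {s t x} → s ∉ Spec.member 𝔭 → Clears 𝔭 α (s • t) (s • x) → Clears 𝔭 α t x
      clears-cancel {s} {t} {x} s∉ (clearing w w∉ p) =
        clearing (w • s) (MultiplicativeSet.•-closed (complement A sa 𝔭) w∉ s∉) (begin
        (w • s) • (t • y)  ≈⟨ •-assoc w s _ ⟨
        w • (s • (t • y))  ≈⟨ •-congʳ w (•-assoc s t y) ⟩
        w • ((s • t) • y)  ≈⟨ p ⟩
        w • (u • (s • x))  ≈⟨ •-congʳ w (•-swap u s x) ⟩
        w • (s • (u • x))  ≈⟨ •-assoc w s _ ⟩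
        (w • s) • (u • x)  ∎)

      -- The product `W` serves as factor for all components at once; linearity of `combine` moves
      -- `W` in, and `W` and the denominator of α out again.
      clears-combine : ∀ {Y} (b d : El Y) (c : ∣ Y ∣ → El [1]) (x : ∣ Y ∣ → El X) →
                       (∀ i → Clears 𝔭 α (c i) (x i)) →
                       Clears 𝔭 α ⟨ b ∘[ idᵖ ] diag c ∣[ ! Y ] ⌜ d ⌝ ⟩ (combine b x d)
      clears-combine {Y} b d c x p = clearing W W∉ (begin
        W • (⟨ b ∘[ idᵖ ] diag c ∣[ ! Y ] ⌜ d ⌝ ⟩ • y)  ≈⟨ •-congʳ W (combine-action b d c y) ⟩
        W • combine b (λ i → c i • y) d     ≈⟨ combine-• b d W _ ⟨
        combine b (λ i → W • (c i • y)) d   ≈⟨ combine-cong b d (∏-equalizes {Y} w (λ i → Clears.equality (p i))) ⟩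
        combine b (λ i → W • (u • x i)) d   ≈⟨ combine-• b d W _ ⟩
        W • combine b (λ i → u • x i) d     ≈⟨ •-congʳ W (combine-• b d u x) ⟩
        W • (u • combine b x d)             ∎)
        where
        w = λ i → Clears.factor (p i)
        W = ∏ {Y} w
        open MultiplicativeSet (complement A sa 𝔭)
        W∉ = ∏-closed {Y} w member 1∈ •-closed (λ i → Clears.factor∉ (p i))

    -- Sections over D_s as global fractions.

    module _ {u} (U : Open A u) (s : El [1])
             (U-D : ∀ 𝔭 → 𝔭 ∈ Open.points U ⇔ s ∉ Spec.member 𝔭) where

      private
        toD = λ 𝔭 → Equivalence.to (U-D 𝔭)
        fromD = λ 𝔭 → Equivalence.from (U-D 𝔭)

      module _ {X : FinSet} (σ : Section A sa U X) where

        ClearsNear : El [1] → El [1] → El X → Set _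
        ClearsNear e t x = ∀ 𝔮 (𝔮∈ : 𝔮 ∈ Open.points U) → e ∉ Spec.member 𝔮 → Clears 𝔮 (at σ 𝔮 𝔮∈) t x

        globalDen : Pred (El [1]) _
        globalDen t = ∃[ x ] (∀ 𝔮 (𝔮∈ : 𝔮 ∈ Open.points U) → Clears 𝔮 (at σ 𝔮 𝔮∈) t x)

        globalDen-isHIdeal : IsHIdeal A globalDen
        globalDen-isHIdeal = record
          { resp   = λ e (x , p) → x , λ 𝔮 𝔮∈ → clears-cong 𝔮 e ≈-refl (p 𝔮 𝔮∈)
          ; closed = λ b d c cs → combine b (λ i → proj₁ (cs i)) d ,
              λ 𝔮 𝔮∈ → clears-combine 𝔮 b d c _ (λ i → proj₂ (cs i) 𝔮 𝔮∈)
          }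

        module _ (𝔭 : Spec A) (t : El [1]) (x : El X) where

          -- On D_e the element `g • t` may lie in primes, so the condition there is `Clears` rather
          -- than an equality of fractions; `g` may depend on `e`.
          extension : Pred (El [1]) _
          extension e = ∃[ g ] (g ∉ Spec.member 𝔭 × ClearsNear e (g • t) (g • x))

          -- A prime missing (b ∘ c , d) misses some component of c.
          extension-isHIdeal : IsHIdeal A extension
          extension-isHIdeal = record
            { resp   = λ e≈ (g , g∉ , p) → g , g∉ ,
                λ 𝔮 𝔮∈ e∉ → p 𝔮 𝔮∈ (λ e∈ → e∉ (Spec.resp 𝔮 e≈ e∈))
            ; closed = λ {Y} b d c cs →
                let g = λ i → proj₁ (cs i)
                    open MultiplicativeSet (complement A sa 𝔭)
                in ∏ {Y} g , ∏-closed {Y} g member 1∈ •-closed (λ i → proj₁ (proj₂ (cs i))) ,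
                λ 𝔮 𝔮∈ e∉ → case em {P = ∃[ i ] c i ∉ Spec.member 𝔮} of λ
                  { (no none)      → contradiction (Spec.closed 𝔮 b d c
                                       (λ i → decidable-stable em (λ c∉ → none (i , c∉)))) e∉
                  -- `z • g i` is the product of all the `g`, so scaling the relation for `g i` by
                  -- `z` gives the one for the common factor.
                  ; (yes (i , c∉)) → let z = cofactor {Y} g i in
                      clears-cong 𝔮 (cofactor-• {Y} g i t) (cofactor-• {Y} g i x)
                        (clears-• 𝔮 z (proj₂ (proj₂ (cs i)) 𝔮 𝔮∈ c∉))
                  }
            }

        near : ∀ 𝔭 𝔭∈ → Basic A sa U (at σ) 𝔭
        near 𝔭 𝔭∈ = toBasic A sa U (locallyFraction σ 𝔭 𝔭∈)

        -- The element `e` is the centre q of the fraction near 𝔮. With p the centre near 𝔭, both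
        -- fractions agree on D_pq, hence after multiplication by (pq)ⁿ. The part pⁿ becomes `g`;
        -- the part qⁿ is invertible at every prime of D_q and serves as a factor there.
        fraction-extends : ∀ 𝔭 𝔭∈ → let module P = Basic (near 𝔭 𝔭∈) in
                           ∀ 𝔮 → 𝔮 ∈ Open.points U → ∃[ e ] (e ∈ extension 𝔭 P.den P.num × e ∉ Spec.member 𝔮)
        fraction-extends 𝔭 𝔭∈ 𝔮 𝔮∈ = Q.centre , (g , ^-closed A sa 𝔭 P.centre n P.𝔭∌ , clears) , Q.𝔭∌
          where
          module P = Basic (near 𝔭 𝔭∈)
          module Q = Basic (near 𝔮 𝔮∈)
          agree : ∃[ n ] (P.centre • Q.centre) ↑ n • (Q.den • P.num) ≈ (P.centre • Q.centre) ↑ n • (P.den • Q.num)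
          agree = equal-after-power (P.centre • Q.centre) λ 𝔯 ∌PQ →
            let P∌ = λ 𝔯∋ → ∌PQ (Spec.resp 𝔯 (•-comm sa Q.centre P.centre) (•-absorbs (Spec.isHIdeal 𝔯) Q.centre 𝔯∋))
                Q∌ = λ 𝔯∋ → ∌PQ (•-absorbs (Spec.isHIdeal 𝔯) P.centre 𝔯∋)
                𝔯∈ = P.⊆U 𝔯 P∌
                L.witness w w∉ e = L.≈ᴸ-trans 𝔯 (L.≈ᴸ-sym 𝔯 (P.value 𝔯 P∌ 𝔯∈)) (Q.value 𝔯 Q∌ 𝔯∈)
            in w , w∉ , e
          n = proj₁ agree
          g = P.centre ↑ n
          h = Q.centre ↑ n
          swapped : h • (g • (P.den • Q.num)) ≈ h • (Q.den • (g • P.num))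
          swapped = begin
            h • (g • (P.den • Q.num))                       ≈⟨ gather _ ⟩
            (P.centre • Q.centre) ↑ n • (P.den • Q.num)     ≈⟨ proj₂ agree ⟨
            (P.centre • Q.centre) ↑ n • (Q.den • P.num)     ≈⟨ gather _ ⟨
            h • (g • (Q.den • P.num))                       ≈⟨ •-congʳ h (•-swap g Q.den P.num) ⟩
            h • (Q.den • (g • P.num))                       ∎
            where
            gather : ∀ z → h • (g • z) ≈ (P.centre • Q.centre) ↑ n • z
            gather z = ≈-trans (•-assoc h g z)
              (•-cong (≈-trans (•-comm sa h g) (≈-sym (•-^ P.centre Q.centre n))) ≈-refl)
          clears : ClearsNear Q.centre (g • P.den) (g • P.num)
          -- The relation from the fraction near 𝔮 is multiplied by `g • P.den`, its numerator is
          -- exchanged by `swapped`, and `Q.den` is cancelled.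
          clears 𝔯 𝔯∈ Q∌ = clears-cancel 𝔯 (Q.den∉ 𝔯 Q∌)
            (clears-equal 𝔯 (^-closed A sa 𝔯 Q.centre n Q∌) swapped
              (clears-cong 𝔯 (solve 3 (λ g t u → g ⊕ (t ⊕ u) ⊜ u ⊕ (g ⊕ t)) ≈-refl g P.den Q.den) ≈-refl
                (clears-• 𝔯 g (clears-• 𝔯 P.den (≈-clears 𝔯 (Q.value 𝔯 Q∌ 𝔯∈))))))

        -- A power of `s` in `extension` makes the relation with `g • P.den` hold on all of U, as no
        -- prime of U contains that power.
        globalDen-escapes : ∀ 𝔭 (𝔭∈ : 𝔭 ∈ Open.points U) → ∃[ t ] (t ∈ globalDen × t ∉ Spec.member 𝔭)
        globalDen-escapes 𝔭 𝔭∈ =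
          let n , g , g∉ , p = power-in (extension-isHIdeal 𝔭 P.den P.num) s
                                 (λ 𝔮 s∉ → fraction-extends 𝔭 𝔭∈ 𝔮 (fromD 𝔮 s∉))
          in g • P.den , (g • P.num , λ 𝔮 𝔮∈ → p 𝔮 𝔮∈ (^-closed A sa 𝔮 s n (toD 𝔮 𝔮∈))) ,
             MultiplicativeSet.•-closed (complement A sa 𝔭) g∉ (P.den∉ 𝔭 P.𝔭∌)
          where module P = Basic (near 𝔭 𝔭∈)

        -- Only the points of U are compared with D_s, so the result serves both `basicOpen` and,
        -- with `s` the unit, `spec`.
        globalFraction : ∃[ n ] ∃[ x ] (∀ 𝔭 (𝔭∈ : 𝔭 ∈ Open.points U) → Clears 𝔭 (at σ 𝔭 𝔭∈) (s ↑ n) x)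
        globalFraction = power-in globalDen-isHIdeal s (λ 𝔭 s∉ → globalDen-escapes 𝔭 (fromD 𝔭 s∉))

    -- The isomorphism Ψ over D_s.

    module _ (s : El [1]) where

      private
        module F = Localization A sa (powers A sa s)

      power∉ : ∀ 𝔭 → s ∉ Spec.member {A = A} 𝔭 → ∀ {t} → t ∈ MultiplicativeSet.member (powers A sa s) →
               t ∉ Spec.member 𝔭
      power∉ 𝔭 s∉ (n , e) t∈ = ^-closed A sa 𝔭 s n s∉ (Spec.resp 𝔭 e t∈)

      Ψ-cong : ∀ {X} {α β : F.Fraction X} → α F.≈ᴸ β → _≈ˢ_ A sa (basicOpen A s) (Ψ A sa s X α) (Ψ A sa s X β)
      Ψ-cong (F.witness w w∈ e) = record { pointwise = λ 𝔭 s∉ → L.witness w (power∉ 𝔭 s∉ w∈) e }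

      -- Common denominators and numerators are formed by the same products and cofactors in A_s and
      -- in each A_𝔭, so both sides differ only in membership proofs.
      Ψ-isHomomorphism : IsHomomorphism (Aₛ A sa s) (𝒪 A sa (basicOpen A s)) (Ψ A sa s)
      Ψ-isHomomorphism = record
        { φ-cong   = λ X → Ψ-cong
        ; 0-homo   = λ X → record { pointwise = λ 𝔭 _ → L.witness 1# (Spec.proper 𝔭) ≈-refl }
        ; 1-homo   = record { pointwise = λ 𝔭 _ → L.witness 1# (Spec.proper 𝔭) ≈-refl }
        ; act-homo = λ f α → record { pointwise = λ 𝔭 _ → L.witness 1# (Spec.proper 𝔭) ≈-refl }
        ; ∘-homo   = λ f α β → record { pointwise = λ 𝔭 _ → L.witness 1# (Spec.proper 𝔭) ≈-refl }
        ; ⟨⟩-homo  = λ f α β → record { pointwise = λ 𝔭 _ → L.witness 1# (Spec.proper 𝔭) ≈-refl }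
        }

      Ψ-injective : ∀ X → Injective F._≈ᴸ_ (_≈ˢ_ A sa (basicOpen A s)) (Ψ A sa s X)
      Ψ-injective X p =
        -- Applied to the cross-multiplied numerators: the factors outside each 𝔭 give way to a
        -- power of `s`, which A_s admits.
        let n , e = equal-after-power s (λ 𝔭 s∉ → let L.witness w w∉ e = pointwise p 𝔭 s∉ in w , w∉ , e)
        in F.witness (s ↑ n) (n , ≈-refl) e

      Ψ-surjective : ∀ X → Surjective F._≈ᴸ_ (_≈ˢ_ A sa (basicOpen A s)) (Ψ A sa s X)
      Ψ-surjective X σ =
        let n , x , clears = globalFraction (basicOpen A s) s (λ _ → mk⇔ id id) σ
        in x F./ (s ↑ n , n , ≈-refl) , λ z≈ → record { pointwise = λ 𝔭 s∉ →
             L.≈ᴸ-trans 𝔭 (pointwise (Ψ-cong z≈) 𝔭 s∉) (L.≈ᴸ-sym 𝔭 (clears-≈ 𝔭 (clears 𝔭 s∉))) }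

      Ψ-isIsomorphism : IsIsomorphism (Aₛ A sa s) (𝒪 A sa (basicOpen A s)) (Ψ A sa s)
      Ψ-isIsomorphism = record
        { isHomomorphism = Ψ-isHomomorphism
        ; bijective      = λ X → Ψ-injective X , Ψ-surjective X
        }

    -- The isomorphism Φ over the whole spectrum.

    1^ : ∀ n → 1# ↑ n ≈ 1#
    1^ zero    = ≈-refl
    1^ (suc n) = ≈-trans (•-identityˡ _) (1^ n)

    1^-cancel : ∀ {X} n {x y : El X} → 1# ↑ n • x ≈ 1# ↑ n • y → x ≈ y
    1^-cancel n {x} {y} e = ≈-trans (≈-sym (trivial x)) (≈-trans e (trivial y))
      where
      trivial : ∀ z → 1# ↑ n • z ≈ z
      trivial z = ≈-trans (•-cong (1^ n) ≈-refl) (•-identityˡ z)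

    Φ-cong : ∀ {X} {x y : El X} → x ≈ y → _≈ˢ_ A sa (spec A) (Φ A sa X x) (Φ A sa X y)
    Φ-cong e = record { pointwise = λ 𝔭 _ → L./-cong 𝔭 e ≈-refl }

    Φ-isHomomorphism : IsHomomorphism A (𝒪 A sa (spec A)) (Φ A sa)
    Φ-isHomomorphism = record
      { φ-cong   = λ X → Φ-cong
      ; 0-homo   = λ X → record { pointwise = λ 𝔭 _ → L.witness 1# (Spec.proper 𝔭) ≈-refl }
      ; 1-homo   = record { pointwise = λ 𝔭 _ → L.witness 1# (Spec.proper 𝔭) ≈-refl }
      ; act-homo = λ f x → record { pointwise = λ 𝔭 _ → L.witness 1# (Spec.proper 𝔭) ≈-refl }
      -- The section side carries products of ones as denominators and cofactors, so the sides agree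
      -- only up to `≈ᴸ`; `∘-frac` recomputes the operation over the denominator 1.
      ; ∘-homo   = λ f x b → record { pointwise = λ 𝔭 _ → L.≈ᴸ-sym 𝔭 (L.≈ᴸ-trans 𝔭
          (L.∘-frac 𝔭 f {s = L.1ᴰ 𝔭} {b = b} {t = L.1ᴰ 𝔭} (L.≈ᴸ-refl 𝔭) (λ _ → L.≈ᴸ-refl 𝔭))
          (L./-cong 𝔭 ≈-refl (•-identityˡ 1#))) }
      ; ⟨⟩-homo  = λ f x b → record { pointwise = λ 𝔭 _ → L.≈ᴸ-sym 𝔭 (L.≈ᴸ-trans 𝔭
          (L.⟨⟩-frac 𝔭 f {s = L.1ᴰ 𝔭} {b = b} {t = L.1ᴰ 𝔭} (L.≈ᴸ-refl 𝔭) (λ _ → L.≈ᴸ-refl 𝔭))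
          (L./-cong 𝔭 ≈-refl (•-identityˡ 1#))) }
      }

    Φ-injective : ∀ X → Injective _≈_ (_≈ˢ_ A sa (spec A)) (Φ A sa X)
    Φ-injective X {x} {y} p =
      -- Equality of x/1 and y/1 in A_𝔭 compares the numerators after cross-multiplication by 1.
      let n , e = equal-after-power 1# {1# • x} {1# • y}
                    (λ 𝔭 _ → let L.witness w w∉ e = pointwise p 𝔭 tt in w , w∉ , e)
      in ≈-trans (≈-sym (•-identityˡ x)) (≈-trans (1^-cancel n e) (•-identityˡ y))

    Φ-surjective : ∀ X → Surjective _≈_ (_≈ˢ_ A sa (spec A)) (Φ A sa X)
    Φ-surjective X σ =
      let n , x , clears = globalFraction (spec A) 1# (λ 𝔭 → mk⇔ (λ _ → Spec.proper 𝔭) (λ _ → tt)) σ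
      in x , λ z≈ → record { pointwise = λ 𝔭 _ → L.≈ᴸ-trans 𝔭 (pointwise (Φ-cong z≈) 𝔭 tt)
           (L.≈ᴸ-sym 𝔭 (clears-≈ 𝔭 (clears-cong 𝔭 (1^ n) ≈-refl (clears 𝔭 tt)))) }

    Φ-isIsomorphism : IsIsomorphism A (𝒪 A sa (spec A)) (Φ A sa)
    Φ-isIsomorphism = record
      { isHomomorphism = Φ-isHomomorphism
      ; bijective      = λ X → Φ-injective X , Φ-surjective X
      }

theorem5p3p5 : (∀ {ℓ} → ExcludedMiddle ℓ) →
    (∀ {c ℓ₁ ℓ₂ r} → Zorn c ℓ₁ ℓ₂ r) →
    ∀ {a ℓ} (A : GeneralizedRing a ℓ) (sa : SelfAdjoint A) (s : GeneralizedRing.El A [1]) →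
    IsIsomorphism (Aₛ A sa s) (𝒪 A sa (basicOpen A s)) (Ψ A sa s) ×
    IsIsomorphism A (𝒪 A sa (spec A)) (Φ A sa)
theorem5p3p5 em zorn A sa s =
  Classical.Ψ-isIsomorphism em zorn A sa s , Classical.Φ-isIsomorphism em zorn A sa
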